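{- Let $G$ be a conference graph of order $v > 9$, i.e. a strongly regular graph with parameters $(v,k,\lambda,\mu) = \left(v, \frac{v-1}{2}, \frac{v-5}{4}, \frac{v-1}{4}\right)$. Then $G$ is optimistic: the distance matrix $D(G)$ has strictly more positive eigenvalues than negative eigenvalues, i.e. $n_{+}(G) > n_{ - }(G)$.
   Context: For a connected graph $G$, the distance matrix $D(G)$ is the matrix indexed by vertices whose $(u,w)$ entry is the graph distance $d(u,w)$. $n_{+}(G)$ and $n_{ - }(G)$ denote the number of strictly positive and strictly negative eigenvalues of $D(G)$ (counted with multiplicity). A graph is called optimistic if $n_{+}(G) > n_{ - }(G)$. A strongly regular graph with parameters $(v,k,\lambda,\mu)$ is a $k$-regular graph on $v$ vertices in which every pair of adjacent vertices has exactly $\lambda$ common neighbours and every pair of distinct non-adjacent vertices has exactly $\mu$ common neighbours. -}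

module Defs where

open import Level using (0ℓ)
open import Algebra.Bundles using (CommutativeMonoid)
open import Algebra.Bundles.Raw using (RawMonoid)
open import Data.Nat.Base as ℕ using (ℕ; suc)
import Data.Nat.Properties as ℕ
open import Data.Integer.Base using (+_)
open import Data.Rational.Base as ℚ using (ℚ; 0ℚ; 1ℚ; ½; ∣_∣; Positive; 1/_)
import Data.Rational.Properties as ℚ
import Algebra.Properties.CommutativeSemigroup as CommutativeSemigroupProperties
import Algebra.Properties.Ring as RingProperties
open import Data.Fin.Base using (Fin)
open import Data.Fin.Subset using (Subset; _∩_) renaming (∣_∣ to card)
open import Data.Product.Base using (Σ; ∃; ∃₂; _×_; _,_)
open import Data.Vec.Base using (tabulate)
open import Data.Vec.Functional using (Vector)
import Algebra.Definitions.RawMonoid as RawMonoidDefs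
open import Relation.Binary.Core using (Rel)
open import Relation.Binary.Definitions using (Decidable; Symmetric; Irreflexive)
open import Relation.Binary.PropositionalEquality using (_≡_; _≢_; refl; sym; trans; cong; cong₂; module ≡-Reasoning)
open import Relation.Nullary using (¬_; does)

------------------------------------------------------------------------
-- Real numbers, as Cauchy sequences of rationals

IsCauchy : (ℕ → ℚ) → Set
IsCauchy f = ∀ ε → 0ℚ ℚ.< ε →
  ∃ λ N → ∀ m n → N ℕ.≤ m → N ℕ.≤ n → ∣ f m ℚ.- f n ∣ ℚ.< ε

record ℝ : Set where
  constructor mkℝ
  field
    seq    : ℕ → ℚ
    cauchy : IsCauchy seq

open ℝ public

infix 4 _≈_ _<_

_≈_ : Rel ℝ 0ℓ
x ≈ y = ∀ ε → 0ℚ ℚ.< ε →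
  ∃ λ N → ∀ n → N ℕ.≤ n → ∣ seq x n ℚ.- seq y n ∣ ℚ.< ε

_<_ : Rel ℝ 0ℓ
x < y = ∃ λ ε → 0ℚ ℚ.< ε ×
  ∃ λ N → ∀ n → N ℕ.≤ n → seq x n ℚ.+ ε ℚ.< seq y n

-- Opaque, as conversion checking otherwise unfolds these proofs inside every real.
abstract
  const-cauchy : ∀ q → IsCauchy (λ _ → q)
  const-cauchy q ε 0<ε = 0 , λ _ _ _ _ → begin-strict
    ∣ q ℚ.- q ∣  ≡⟨ cong ∣_∣ (ℚ.+-inverseʳ q) ⟩
    0ℚ           <⟨ 0<ε ⟩
    ε            ∎
    where open ℚ.≤-Reasoning

  add-difference : ∀ a b → a ℚ.+ (b ℚ.- a) ≡ b
  add-difference a b = trans (ℚ.+-comm a (b ℚ.- a))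
    (trans (ℚ.+-assoc b (ℚ.- a) a)
    (trans (cong (b ℚ.+_) (ℚ.+-inverseˡ a)) (ℚ.+-identityʳ b)))

  +-difference : ∀ a b c d → (a ℚ.+ b) ℚ.- (c ℚ.+ d) ≡ (a ℚ.- c) ℚ.+ (b ℚ.- d)
  +-difference a b c d = trans (cong (a ℚ.+ b ℚ.+_) (ℚ.neg-distrib-+ c d))
    (interchange a b (ℚ.- c) (ℚ.- d))
    where
    interchange : ∀ p q r s → (p ℚ.+ q) ℚ.+ (r ℚ.+ s) ≡ (p ℚ.+ r) ℚ.+ (q ℚ.+ s)
    interchange = CommutativeSemigroupProperties.interchange
      (CommutativeMonoid.commutativeSemigroup ℚ.+-0-commutativeMonoid)

  *-difference : ∀ a b c d →
    a ℚ.* b ℚ.- c ℚ.* d ≡ a ℚ.* (b ℚ.- d) ℚ.+ d ℚ.* (a ℚ.- c)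
  *-difference a b c d = begin
    a ℚ.* b ℚ.- c ℚ.* d
      ≡⟨ cong (ℚ._- c ℚ.* d) (sym (add-difference (a ℚ.* d) (a ℚ.* b))) ⟩
    (a ℚ.* d ℚ.+ (a ℚ.* b ℚ.- a ℚ.* d)) ℚ.- c ℚ.* d
      ≡⟨ cong (ℚ._- c ℚ.* d) (ℚ.+-comm (a ℚ.* d) (a ℚ.* b ℚ.- a ℚ.* d)) ⟩
    ((a ℚ.* b ℚ.- a ℚ.* d) ℚ.+ a ℚ.* d) ℚ.- c ℚ.* d
      ≡⟨ ℚ.+-assoc (a ℚ.* b ℚ.- a ℚ.* d) (a ℚ.* d) (ℚ.- (c ℚ.* d)) ⟩
    (a ℚ.* b ℚ.- a ℚ.* d) ℚ.+ (a ℚ.* d ℚ.- c ℚ.* d)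
      ≡⟨ sym (cong₂ ℚ._+_ (x[y-z]≈xy-xz a b d) ([y-z]x≈yx-zx d a c)) ⟩
    a ℚ.* (b ℚ.- d) ℚ.+ (a ℚ.- c) ℚ.* d
      ≡⟨ cong (a ℚ.* (b ℚ.- d) ℚ.+_) (ℚ.*-comm (a ℚ.- c) d) ⟩
    a ℚ.* (b ℚ.- d) ℚ.+ d ℚ.* (a ℚ.- c) ∎
    where
    open ≡-Reasoning
    open RingProperties ℚ.+-*-ring using (x[y-z]≈xy-xz; [y-z]x≈yx-zx)

  ½*-pos : ∀ {ε} → 0ℚ ℚ.< ε → 0ℚ ℚ.< ½ ℚ.* ε
  ½*-pos 0<ε = ℚ.*-monoʳ-<-pos ½ 0<ε

  ½+½ : ∀ ε → ½ ℚ.* ε ℚ.+ ½ ℚ.* ε ≡ ε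
  ½+½ ε = trans (sym (ℚ.*-distribʳ-+ ε ½ ½)) (ℚ.*-identityˡ ε)

  +-cauchy : ∀ f g → IsCauchy f → IsCauchy g → IsCauchy (λ n → f n ℚ.+ g n)
  +-cauchy f g cf cg ε 0<ε
    with cf (½ ℚ.* ε) (½*-pos 0<ε) | cg (½ ℚ.* ε) (½*-pos 0<ε)
  ... | N , hf | M , hg = N ℕ.⊔ M , λ m n N⊔M≤m N⊔M≤n → begin-strict
    ∣ (f m ℚ.+ g m) ℚ.- (f n ℚ.+ g n) ∣      ≡⟨ cong ∣_∣ (+-difference (f m) (g m) (f n) (g n)) ⟩
    ∣ (f m ℚ.- f n) ℚ.+ (g m ℚ.- g n) ∣      ≤⟨ ℚ.∣p+q∣≤∣p∣+∣q∣ (f m ℚ.- f n) (g m ℚ.- g n) ⟩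
    ∣ f m ℚ.- f n ∣ ℚ.+ ∣ g m ℚ.- g n ∣      <⟨ ℚ.+-mono-<
      (hf m n (ℕ.m⊔n≤o⇒m≤o N M N⊔M≤m) (ℕ.m⊔n≤o⇒m≤o N M N⊔M≤n))
      (hg m n (ℕ.m⊔n≤o⇒n≤o N M N⊔M≤m) (ℕ.m⊔n≤o⇒n≤o N M N⊔M≤n)) ⟩
    ½ ℚ.* ε ℚ.+ ½ ℚ.* ε                      ≡⟨ ½+½ ε ⟩
    ε                                        ∎
    where
    open ℚ.≤-Reasoning

  cauchy-bounded : ∀ f → IsCauchy f →
    ∃₂ λ B N → Positive B × (∀ n → N ℕ.≤ n → ∣ f n ∣ ℚ.< B)
  cauchy-bounded f cf with cf 1ℚ (ℚ.positive⁻¹ 1ℚ)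
  ... | N , hf = ∣ f N ∣ ℚ.+ 1ℚ , N , positive , λ n N≤n → begin-strict
    ∣ f n ∣                          ≡⟨ cong ∣_∣ (sym (add-difference (f N) (f n))) ⟩
    ∣ f N ℚ.+ (f n ℚ.- f N) ∣        ≤⟨ ℚ.∣p+q∣≤∣p∣+∣q∣ (f N) (f n ℚ.- f N) ⟩
    ∣ f N ∣ ℚ.+ ∣ f n ℚ.- f N ∣      <⟨ ℚ.+-monoʳ-< ∣ f N ∣ (hf n N N≤n ℕ.≤-refl) ⟩
    ∣ f N ∣ ℚ.+ 1ℚ                   ∎
    where
    open ℚ.≤-Reasoning
    positive : Positive (∣ f N ∣ ℚ.+ 1ℚ)
    positive = ℚ.positive (ℚ.+-mono-≤-< (ℚ.0≤∣p∣ (f N)) (ℚ.positive⁻¹ 1ℚ))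

  *-small : ∀ p q B ε (posB : Positive B) → ∣ p ∣ ℚ.< B →
    ∣ q ∣ ℚ.< (1/ B) {{ℚ.pos⇒nonZero B {{posB}}}} ℚ.* ε → ∣ p ℚ.* q ∣ ℚ.< ε
  *-small p q B ε posB p<B q<ε/B = begin-strict
    ∣ p ℚ.* q ∣          ≡⟨ ℚ.∣p*q∣≡∣p∣*∣q∣ p q ⟩
    ∣ p ∣ ℚ.* ∣ q ∣      ≤⟨ ℚ.*-monoʳ-≤-nonNeg ∣ q ∣ {{ℚ.∣-∣-nonNeg q}} (ℚ.<⇒≤ p<B) ⟩
    B ℚ.* ∣ q ∣          <⟨ ℚ.*-monoʳ-<-pos B {{posB}} q<ε/B ⟩
    B ℚ.* (B⁻¹ ℚ.* ε)    ≡⟨ sym (ℚ.*-assoc B B⁻¹ ε) ⟩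
    (B ℚ.* B⁻¹) ℚ.* ε    ≡⟨ cong (ℚ._* ε) (ℚ.*-inverseʳ B {{ℚ.pos⇒nonZero B {{posB}}}}) ⟩
    1ℚ ℚ.* ε             ≡⟨ ℚ.*-identityˡ ε ⟩
    ε                    ∎
    where
    open ℚ.≤-Reasoning
    B⁻¹ : ℚ
    B⁻¹ = (1/ B) {{ℚ.pos⇒nonZero B {{posB}}}}

  1/*-pos : ∀ B ε (posB : Positive B) → 0ℚ ℚ.< ε →
    0ℚ ℚ.< (1/ B) {{ℚ.pos⇒nonZero B {{posB}}}} ℚ.* ε
  1/*-pos B ε posB 0<ε = begin-strict
    0ℚ           ≡⟨ sym (ℚ.*-zeroʳ B⁻¹) ⟩
    B⁻¹ ℚ.* 0ℚ   <⟨ ℚ.*-monoʳ-<-pos B⁻¹ {{ℚ.1/pos⇒pos B {{posB}}}} 0<ε ⟩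
    B⁻¹ ℚ.* ε    ∎
    where
    open ℚ.≤-Reasoning
    B⁻¹ : ℚ
    B⁻¹ = (1/ B) {{ℚ.pos⇒nonZero B {{posB}}}}

  *-cauchy : ∀ f g → IsCauchy f → IsCauchy g → IsCauchy (λ n → f n ℚ.* g n)
  *-cauchy f g cf cg ε 0<ε
    with cauchy-bounded f cf | cauchy-bounded g cg
  ... | A , Nᵃ , posA , f<A | B , Nᵇ , posB , g<B
    with cf _ (1/*-pos B (½ ℚ.* ε) posB (½*-pos 0<ε)) | cg _ (1/*-pos A (½ ℚ.* ε) posA (½*-pos 0<ε))
  ... | N , hf | M , hg = (Nᵃ ℕ.⊔ Nᵇ) ℕ.⊔ (N ℕ.⊔ M) , λ m n ≤m ≤n →
    let Nᵃ≤m = ℕ.m⊔n≤o⇒m≤o Nᵃ Nᵇ (ℕ.m⊔n≤o⇒m≤o (Nᵃ ℕ.⊔ Nᵇ) (N ℕ.⊔ M) ≤m)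
        Nᵇ≤n = ℕ.m⊔n≤o⇒n≤o Nᵃ Nᵇ (ℕ.m⊔n≤o⇒m≤o (Nᵃ ℕ.⊔ Nᵇ) (N ℕ.⊔ M) ≤n)
        N⊔M≤m = ℕ.m⊔n≤o⇒n≤o (Nᵃ ℕ.⊔ Nᵇ) (N ℕ.⊔ M) ≤m
        N⊔M≤n = ℕ.m⊔n≤o⇒n≤o (Nᵃ ℕ.⊔ Nᵇ) (N ℕ.⊔ M) ≤n
        Δf = hf m n (ℕ.m⊔n≤o⇒m≤o N M N⊔M≤m) (ℕ.m⊔n≤o⇒m≤o N M N⊔M≤n)
        Δg = hg m n (ℕ.m⊔n≤o⇒n≤o N M N⊔M≤m) (ℕ.m⊔n≤o⇒n≤o N M N⊔M≤n)
    in begin-strict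
    ∣ f m ℚ.* g m ℚ.- f n ℚ.* g n ∣
      ≡⟨ cong ∣_∣ (*-difference (f m) (g m) (f n) (g n)) ⟩
    ∣ f m ℚ.* (g m ℚ.- g n) ℚ.+ g n ℚ.* (f m ℚ.- f n) ∣
      ≤⟨ ℚ.∣p+q∣≤∣p∣+∣q∣ (f m ℚ.* (g m ℚ.- g n)) (g n ℚ.* (f m ℚ.- f n)) ⟩
    ∣ f m ℚ.* (g m ℚ.- g n) ∣ ℚ.+ ∣ g n ℚ.* (f m ℚ.- f n) ∣
      <⟨ ℚ.+-mono-< (*-small (f m) (g m ℚ.- g n) A (½ ℚ.* ε) posA (f<A m Nᵃ≤m) Δg)
                    (*-small (g n) (f m ℚ.- f n) B (½ ℚ.* ε) posB (g<B n Nᵇ≤n) Δf) ⟩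
    ½ ℚ.* ε ℚ.+ ½ ℚ.* ε
      ≡⟨ ½+½ ε ⟩
    ε ∎
    where
    open ℚ.≤-Reasoning

infixl 6 _+_
infixl 7 _*_

_+_ : ℝ → ℝ → ℝ
x + y = mkℝ (λ n → seq x n ℚ.+ seq y n) (+-cauchy (seq x) (seq y) (cauchy x) (cauchy y))

_*_ : ℝ → ℝ → ℝ
x * y = mkℝ (λ n → seq x n ℚ.* seq y n) (*-cauchy (seq x) (seq y) (cauchy x) (cauchy y))

fromℚ : ℚ → ℝ
fromℚ q = mkℝ (λ _ → q) (const-cauchy q)

fromℕ : ℕ → ℝ
fromℕ n = fromℚ (+ n ℚ./ 1)

0ℝ : ℝ
0ℝ = fromℚ 0ℚ

+-0-rawMonoid : RawMonoid 0ℓ 0ℓ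
+-0-rawMonoid = record { Carrier = ℝ ; _≈_ = _≈_ ; _∙_ = _+_ ; ε = 0ℝ }

open RawMonoidDefs +-0-rawMonoid public using (sum)
open RawMonoidDefs ℕ.+-0-rawMonoid public using () renaming (sum to sumℕ)

------------------------------------------------------------------------
-- Linear algebra over ℝ

Matrix : ℕ → Set
Matrix n = Fin n → Fin n → ℝ

infix 4 _≋_

_≋_ : ∀ {n} → Rel (Vector ℝ n) 0ℓ
x ≋ y = ∀ i → x i ≈ y i

0ᵛ : ∀ {n} → Vector ℝ n
0ᵛ _ = 0ℝ

_*ᵛ_ : ∀ {n} → Matrix n → Vector ℝ n → Vector ℝ n
(M *ᵛ x) i = sum λ j → M i j * x j

linComb : ∀ {n d} → Vector ℝ d → (Fin d → Vector ℝ n) → Vector ℝ n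
linComb c b i = sum λ j → c j * b j i

record IsBasis {n d} (V : Vector ℝ n → Set) (b : Fin d → Vector ℝ n) : Set where
  field
    members     : ∀ j → V (b j)
    independent : ∀ c → linComb c b ≋ 0ᵛ → c ≋ 0ᵛ
    spanning    : ∀ x → V x → ∃ λ c → linComb c b ≋ x

HasDimension : ∀ {n} → (Vector ℝ n → Set) → ℕ → Set
HasDimension {n} V d = Σ (Fin d → Vector ℝ n) (IsBasis V)

Eigenspace : ∀ {n} → Matrix n → ℝ → Vector ℝ n → Set
Eigenspace M θ x = M *ᵛ x ≋ λ i → θ * x i

IsEigenvalue : ∀ {n} → Matrix n → ℝ → Set
IsEigenvalue M θ = ∃ λ x → ¬ (x ≋ 0ᵛ) × Eigenspace M θ x

-- The eigenvalues of M satisfying P number c in total, each counted with the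
-- dimension of its eigenspace. For the symmetric matrices considered here
-- this agrees with the multiplicity as a root of the characteristic polynomial.
record EigenvalueCount {n} (M : Matrix n) (P : ℝ → Set) (c : ℕ) : Set where
  field
    size         : ℕ
    θ            : Fin size → ℝ
    mult         : Fin size → ℕ
    distinct     : ∀ {i j} → θ i ≈ θ j → i ≡ j
    satisfies    : ∀ i → P (θ i)
    eigenvalue   : ∀ i → IsEigenvalue M (θ i)
    multiplicity : ∀ i → HasDimension (Eigenspace M (θ i)) (mult i)
    exhaustive   : ∀ t → IsEigenvalue M t → P t → ∃ λ i → t ≈ θ i
    total        : sumℕ mult ≡ c

n₊[_]≡_ : ∀ {n} → Matrix n → ℕ → Set
n₊[ M ]≡ p = EigenvalueCount M (λ t → 0ℝ < t) p

n₋[_]≡_ : ∀ {n} → Matrix n → ℕ → Set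
n₋[ M ]≡ q = EigenvalueCount M (λ t → t < 0ℝ) q

------------------------------------------------------------------------
-- Finite simple graphs

record Graph (v : ℕ) : Set₁ where
  field
    _~_    : Rel (Fin v) 0ℓ
    _~?_   : Decidable _~_
    ~-sym  : Symmetric _~_
    ~-irr  : Irreflexive _≡_ _~_

  N : Fin v → Subset v
  N u = tabulate λ w → does (u ~? w)

  data Walk : Fin v → Fin v → ℕ → Set where
    []  : ∀ {u} → Walk u u 0
    _∷_ : ∀ {u w x n} → u ~ w → Walk w x n → Walk u x (suc n)

  IsDistance : Fin v → Fin v → ℕ → Set
  IsDistance u w d = Walk u w d × (∀ n → Walk u w n → d ℕ.≤ n)

record StronglyRegular {v} (G : Graph v) (k l m : ℕ) : Set where
  open Graph G
  field
    regular     : ∀ u → card (N u) ≡ k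
    adjacent    : ∀ u w → u ~ w → card (N u ∩ N w) ≡ l
    nonadjacent : ∀ u w → u ≢ w → ¬ (u ~ w) → card (N u ∩ N w) ≡ m

-- k = (v - 1)/2, l = (v - 5)/4, m = (v - 1)/4, where the divisions are exact.
IsConference : ∀ {v} → Graph v → Set
IsConference {v} G = ∃ λ k → ∃ λ l → ∃ λ m →
  StronglyRegular G k l m ×
  2 ℕ.* k ℕ.+ 1 ≡ v × 4 ℕ.* l ℕ.+ 5 ≡ v × 4 ℕ.* m ℕ.+ 1 ≡ v

IsDistanceMatrix : ∀ {v} → Graph v → Matrix v → Set
IsDistanceMatrix {v} G D = Σ (Fin v → Fin v → ℕ) λ d →
  (∀ u w → Graph.IsDistance G u w (d u w)) × (∀ u w → D u w ≈ fromℕ (d u w))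

-- Distances between all pairs of vertices exist only in a connected graph, so
-- connectedness is part of this definition.
Optimistic : ∀ {v} → Graph v → Set
Optimistic G = ∃ λ D → IsDistanceMatrix G D ×
  ∃₂ λ p q → n₊[ D ]≡ p × n₋[ D ]≡ q × p ℕ.> q

{-# OPTIONS --safe #-}

-- Let v = 4m + 1. The adjacency matrix satisfies A² = m (I + J) - A, and D = 2J - 2I - A
-- because non-adjacent vertices have m > 0 common neighbours. With p = 1/√v, the matrices
-- p² J and (I - p² J ± p (2A - J + I)) / 2 are orthogonal projections onto eigenspaces of D
-- that add up to I. Their traces are 1, 2m, 2m, and the eigenvalues are 6m and (-3 ∓ √v) / 2,
-- so v > 9 gives n₊ = 2m + 1 and n₋ = 2m. No case distinction on whether v is a square is
-- needed, since the traces already determine the dimensions. Constructively, a basis of the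
-- image of a projection is found by choosing positive diagonal entries as pivots.
module Submission where

open import Level using (0ℓ)
open import Algebra.Bundles using (CommutativeRing)
open import Algebra.Structures using (IsCommutativeRing)
import Algebra.Properties.Semiring.Sum
import Algebra.Solver.Ring
open import Algebra.Solver.Ring.AlmostCommutativeRing using (fromCommutativeRing; _-Raw-AlmostCommutative⟶_)
open import Data.Bool.Base using (Bool; true; false; if_then_else_; _∧_)
open import Data.Fin.Base using (Fin; zero; suc)
import Data.Fin.Properties as Fin
open import Data.Fin.Subset using (Subset; _∩_; _∈_) renaming (∣_∣ to card)
import Data.Fin.Subset.Properties as Subset
open import Data.Integer.Base as ℤ using (+_)
import Data.Integer.Properties as ℤ
open import Data.Maybe.Base using (Maybe; just; nothing)
open import Data.Nat.Base as ℕ using (ℕ; zero; suc)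
open import Data.Nat.Coprimality using (1-coprimeTo)
import Data.Nat.Properties as ℕ
import Data.Nat.Solver as ℕ
open import Data.Product.Base using (∃; _×_; _,_; proj₁; proj₂)
open import Data.Rational.Base as ℚ using (ℚ; mkℚ; 0ℚ; 1ℚ; ½; ∣_∣; Positive; 1/_)
import Data.Rational.Properties as ℚ
open import Data.Rational.Solver using (module +-*-Solver)
open import Data.Rational.Unnormalised.Base as ℚᵘ using (mkℚᵘ)
import Data.Rational.Unnormalised.Properties as ℚᵘ
open import Data.Sum.Base using (_⊎_; inj₁; inj₂; [_,_]′; reduce)
open import Data.Vec.Base using (_∷_; tabulate)
open import Data.Vec.Properties using ([]=⇒lookup; lookup∘tabulate)
open import Data.Vec.Functional using (Vector)
open import Relation.Binary.PropositionalEquality as ≡ using (_≡_; _≢_)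
open import Relation.Nullary using (¬_; Dec; yes; no; does; contradiction)
open import Relation.Nullary.Decidable using (dec-true; dec-false)

-- The matrix S = 2A - J + I satisfies S² = vI - J and SJ = 0. Hence pS squares to I - p²J, and
-- halving I - p²J ± pS splits that projection into two. The relation v p² = 1 is the only fact
-- about p that these identities use, so p and -p are served by the same lemmas. The obstacle is
-- constructive: sign and equality of Cauchy reals are undecidable, so an unknown eigenvalue t
-- cannot be compared with the three candidates one by one. It is identified instead by showing that
-- t is apart from all candidates but one. For positive t the gap between the two positive
-- eigenvalues makes this possible, because t lies below the larger or above the smaller of them.
-- The bound on v is where the signs change: at v = 9 the eigenvalue (-3 + √v) / 2 is zero.

ι : ℕ → ℚ
ι n = + n ℚ./ 1

-- `_/_` cancels a gcd that is stuck on a variable `n`. Facts about `ι` are therefore proved for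
-- unnormalised rationals, where the numerator is visible, and carried back.
toℚᵘ-ι : ∀ n → ℚ.toℚᵘ (ι n) ℚᵘ.≃ mkℚᵘ (+ n) 0
toℚᵘ-ι n = ℚ.toℚᵘ-fromℚᵘ (mkℚᵘ (+ n) 0)

ι-+ : ∀ a b → ι (a ℕ.+ b) ≡ ι a ℚ.+ ι b
ι-+ a b = ℚ.toℚᵘ-injective (begin
  ℚ.toℚᵘ (ι (a ℕ.+ b))              ≈⟨ toℚᵘ-ι (a ℕ.+ b) ⟩
  mkℚᵘ (+ (a ℕ.+ b)) 0              ≈⟨ ℚᵘ.*≡* (≡.cong (ℤ._* + 1) (≡.sym (≡.cong₂ ℤ._+_ (ℤ.*-identityʳ (+ a)) (ℤ.*-identityʳ (+ b))))) ⟩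
  mkℚᵘ (+ a) 0 ℚᵘ.+ mkℚᵘ (+ b) 0    ≈⟨ ℚᵘ.+-cong (toℚᵘ-ι a) (toℚᵘ-ι b) ⟨
  ℚ.toℚᵘ (ι a) ℚᵘ.+ ℚ.toℚᵘ (ι b)    ≈⟨ ℚ.toℚᵘ-homo-+ (ι a) (ι b) ⟨
  ℚ.toℚᵘ (ι a ℚ.+ ι b)              ∎)
  where open ℚᵘ.≃-Reasoning

ι-* : ∀ a b → ι (a ℕ.* b) ≡ ι a ℚ.* ι b
ι-* a b = ℚ.toℚᵘ-injective (begin
  ℚ.toℚᵘ (ι (a ℕ.* b))              ≈⟨ toℚᵘ-ι (a ℕ.* b) ⟩
  mkℚᵘ (+ (a ℕ.* b)) 0              ≈⟨ ℚᵘ.*≡* (≡.cong (ℤ._* + 1) (ℤ.pos-* a b)) ⟩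
  mkℚᵘ (+ a) 0 ℚᵘ.* mkℚᵘ (+ b) 0    ≈⟨ ℚᵘ.*-cong (toℚᵘ-ι a) (toℚᵘ-ι b) ⟨
  ℚ.toℚᵘ (ι a) ℚᵘ.* ℚ.toℚᵘ (ι b)    ≈⟨ ℚ.toℚᵘ-homo-* (ι a) (ι b) ⟨
  ℚ.toℚᵘ (ι a ℚ.* ι b)              ∎)
  where open ℚᵘ.≃-Reasoning

ι-mono-≤ : ∀ {a b} → a ℕ.≤ b → ι a ℚ.≤ ι b
ι-mono-≤ {a} {b} a≤b = ℚ.toℚᵘ-cancel-≤ (ℚᵘ.≤-respˡ-≃ (ℚᵘ.≃-sym (toℚᵘ-ι a))
  (ℚᵘ.≤-respʳ-≃ (ℚᵘ.≃-sym (toℚᵘ-ι b)) (ℚᵘ.*≤* (ℤ.*-monoʳ-≤-nonNeg (+ 1) (ℤ.+≤+ a≤b)))))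

ι-mono-< : ∀ {a b} → a ℕ.< b → ι a ℚ.< ι b
ι-mono-< {a} {b} a<b = ℚ.toℚᵘ-cancel-< (ℚᵘ.<-respˡ-≃ (ℚᵘ.≃-sym (toℚᵘ-ι a))
  (ℚᵘ.<-respʳ-≃ (ℚᵘ.≃-sym (toℚᵘ-ι b)) (ℚᵘ.*<* (ℤ.*-monoʳ-<-pos (+ 1) (ℤ.+<+ a<b)))))

open CommutativeRing ℚ.+-*-commutativeRing using () renaming (rawRing to ℚ-rawRing)

-- The properties of ℝ on which the linear algebra rests, kept abstract because conversion
-- checking would otherwise unfold Cauchy sequences.
record OrderedField : Set₁ where
  infix  4 _≈_
  infixl 6 _+_
  infixl 7 _*_
  infix  8 -_
  field
    Carrier           : Set
    _≈_               : Carrier → Carrier → Set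
    _+_ _*_           : Carrier → Carrier → Carrier
    -_                : Carrier → Carrier
    ⟦_⟧               : ℚ → Carrier
    isCommutativeRing : IsCommutativeRing _≈_ _+_ _*_ -_ ⟦ 0ℚ ⟧ ⟦ 1ℚ ⟧
    ⟦⟧-+              : ∀ p q → ⟦ p ℚ.+ q ⟧ ≈ ⟦ p ⟧ + ⟦ q ⟧
    ⟦⟧-*              : ∀ p q → ⟦ p ℚ.* q ⟧ ≈ ⟦ p ⟧ * ⟦ q ⟧
    ⟦⟧-neg            : ∀ p → ⟦ ℚ.- p ⟧ ≈ - ⟦ p ⟧
    Pos               : Carrier → Set
    Pos-respects-≈    : ∀ {x y} → x ≈ y → Pos x → Pos y
    Pos-⟦⟧            : ∀ {q} → 0ℚ ℚ.< q → Pos ⟦ q ⟧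
    Pos-+             : ∀ {x y} → Pos x → Pos y → Pos (x + y)
    -- The constructive remnant of trichotomy: a good enough approximation finds a positive summand,
    -- although the sign of a single real is undecidable.
    Pos-split         : ∀ x y → Pos (x + y) → Pos x ⊎ Pos y
    Pos⇒invertible    : ∀ x → Pos x → ∃ λ y → x * y ≈ ⟦ 1ℚ ⟧
    ¬Pos-square⇒zero  : ∀ x → ¬ Pos (x * x) → x ≈ ⟦ 0ℚ ⟧
    ¬Pos-neg-square   : ∀ x → ¬ Pos (- (x * x))

  commutativeRing : CommutativeRing 0ℓ 0ℓ
  commutativeRing = record { isCommutativeRing = isCommutativeRing }

  open CommutativeRing commutativeRing public
    hiding (Carrier; _≈_; _+_; _*_; -_; isCommutativeRing; zero)

  constants : ℚ-rawRing -Raw-AlmostCommutative⟶ fromCommutativeRing commutativeRing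
  constants = record
    { ⟦_⟧ = ⟦_⟧ ; +-homo = ⟦⟧-+ ; *-homo = ⟦⟧-* ; -‿homo = ⟦⟧-neg ; 0-homo = refl ; 1-homo = refl }

-- Linear algebra over a constructive ordered field

module LinearAlgebra (F : OrderedField) where
  open OrderedField F
  open Algebra.Properties.Semiring.Sum semiring
  open import Relation.Binary.Reasoning.Setoid setoid

  -- The ring solver has to recognise equal coefficients. This is possible for rational constants,
  -- so they serve as coefficients for identities over the field.
  _⟦≟⟧_ : ∀ p q → Maybe (⟦ p ⟧ ≈ ⟦ q ⟧)
  p ⟦≟⟧ q with p ℚ.≟ q
  ... | yes ≡.refl = just refl
  ... | no  _      = nothing

  module Solver = Algebra.Solver.Ring ℚ-rawRing (fromCommutativeRing commutativeRing) constants _⟦≟⟧_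
  open Solver using (solve; _:=_; _:+_; _:*_; _:-_; :-_; con)

  Matrix : ℕ → Set
  Matrix n = Fin n → Fin n → Carrier

  Invertible : Carrier → Set
  Invertible x = ∃ λ y → x * y ≈ 1#

  -- A negative formulation, because a square satisfies it without a decision whether it is positive
  -- or zero.
  NonNeg : Carrier → Set
  NonNeg x = ¬ Pos (- x)

  ¬Pos-0 : ¬ Pos 0#
  ¬Pos-0 pos = ¬Pos-neg-square 0# (Pos-respects-≈ (solve 0 (con 0ℚ := :- (con 0ℚ :* con 0ℚ)) refl) pos)

  Pos⇒¬≈0 : ∀ {x} → Pos x → ¬ (x ≈ 0#)
  Pos⇒¬≈0 pos x≈0 = ¬Pos-0 (Pos-respects-≈ x≈0 pos)

  1≉0 : ¬ (1# ≈ 0#)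
  1≉0 = Pos⇒¬≈0 (Pos-⟦⟧ (ℚ.positive⁻¹ 1ℚ))

  Pos-+-NonNeg : ∀ {x y} → Pos x → NonNeg y → Pos (x + y)
  Pos-+-NonNeg {x} {y} pos nonNeg = [ (λ pos′ → pos′) , (λ neg → contradiction neg nonNeg) ]′
    (Pos-split (x + y) (- y) (Pos-respects-≈ (solve 2 (λ x y → x := x :+ y :+ :- y) refl x y) pos))

  NonNeg-+ : ∀ {x y} → NonNeg x → NonNeg y → NonNeg (x + y)
  NonNeg-+ {x} {y} nx ny neg = [ nx , ny ]′
    (Pos-split (- x) (- y) (Pos-respects-≈ (solve 2 (λ x y → :- (x :+ y) := :- x :+ :- y) refl x y) neg))

  NonNeg-sum : ∀ {n} (f : Vector Carrier n) → (∀ i → NonNeg (f i)) → NonNeg (sum f)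
  NonNeg-sum {zero}  f _ neg = ¬Pos-0 (Pos-respects-≈ (solve 0 (:- con 0ℚ := con 0ℚ) refl) neg)
  NonNeg-sum {suc n} f nonNeg = NonNeg-+ (nonNeg zero) (NonNeg-sum (λ i → f (suc i)) (λ i → nonNeg (suc i)))

  -- Iterating `Pos-split` along the sum produces an explicit index; applied to a trace, it finds a
  -- pivot.
  sum-Pos : ∀ {n} (f : Vector Carrier n) → Pos (sum f) → ∃ λ i → Pos (f i)
  sum-Pos {zero}  f pos = contradiction pos ¬Pos-0
  sum-Pos {suc n} f pos with Pos-split (f zero) (sum λ i → f (suc i)) pos
  ... | inj₁ p = zero , p
  ... | inj₂ p with sum-Pos (λ i → f (suc i)) p
  ... | i , q = suc i , q

  Pos⇒sum-Pos : ∀ {n} (f : Vector Carrier n) → (∀ i → NonNeg (f i)) → ∀ i → Pos (f i) → Pos (sum f)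
  Pos⇒sum-Pos f nonNeg zero pos = Pos-+-NonNeg pos (NonNeg-sum (λ i → f (suc i)) (λ i → nonNeg (suc i)))
  Pos⇒sum-Pos f nonNeg (suc i) pos = Pos-respects-≈ (+-comm (sum λ i → f (suc i)) (f zero))
    (Pos-+-NonNeg (Pos⇒sum-Pos (λ i → f (suc i)) (λ i → nonNeg (suc i)) i pos) (nonNeg zero))

  Pos⇒Invertible : ∀ {x} → Pos x → Invertible x
  Pos⇒Invertible pos = Pos⇒invertible _ pos

  Invertible-neg : ∀ x y → Invertible (x - y) → Invertible (y - x)
  Invertible-neg x y (z , eq) = - z , trans
    (solve 3 (λ x y z → (y :- x) :* :- z := (x :- y) :* z) refl x y z) eq

  Invertible-cancel : ∀ {x y} → Invertible x → x * y ≈ 0# → y ≈ 0#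
  Invertible-cancel {x} {y} (z , xz≈1) xy≈0 = begin
    y            ≈⟨ *-identityˡ y ⟨
    1# * y       ≈⟨ *-congʳ xz≈1 ⟨
    x * z * y    ≈⟨ solve 3 (λ x y z → x :* z :* y := z :* (x :* y)) refl x y z ⟩
    z * (x * y)  ≈⟨ *-congˡ xy≈0 ⟩
    z * 0#       ≈⟨ zeroʳ z ⟩
    0#           ∎

  Invertible-square : ∀ {x} → Invertible (x * x) → Invertible x
  Invertible-square {x} (z , eq) = x * z , trans (sym (*-assoc x x z)) eq

  -- If x² were positive it would be invertible, and x with it. Equations between eigenvalues can
  -- thus be proved by refuting that they are apart.
  ¬Invertible⇒zero : ∀ {x} → ¬ Invertible x → x ≈ 0#
  ¬Invertible⇒zero {x} ¬inv = ¬Pos-square⇒zero x λ pos → ¬inv (Invertible-square (Pos⇒Invertible pos))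

  -- Dot products

  infix 8 _∙_
  _∙_ : ∀ {n} → Vector Carrier n → Vector Carrier n → Carrier
  f ∙ g = sum λ k → f k * g k

  ∙-cong : ∀ {n} {f f′ g g′ : Vector Carrier n} → (∀ k → f k ≈ f′ k) → (∀ k → g k ≈ g′ k) → f ∙ g ≈ f′ ∙ g′
  ∙-cong f≈f′ g≈g′ = sum-cong-≋ λ k → *-cong (f≈f′ k) (g≈g′ k)

  ∙-comm : ∀ {n} (f g : Vector Carrier n) → f ∙ g ≈ g ∙ f
  ∙-comm f g = sum-cong-≋ λ k → *-comm (f k) (g k)

  ∙-zeroˡ : ∀ {n} {f : Vector Carrier n} (g : Vector Carrier n) → (∀ k → f k ≈ 0#) → f ∙ g ≈ 0#
  ∙-zeroˡ {n} g f≈0 = trans (sum-cong-≋ λ k → trans (*-congʳ (f≈0 k)) (zeroˡ (g k))) (sum-replicate-zero n)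

  ∙-zeroʳ : ∀ {n} (f : Vector Carrier n) {g : Vector Carrier n} → (∀ k → g k ≈ 0#) → f ∙ g ≈ 0#
  ∙-zeroʳ f {g} g≈0 = trans (∙-comm f g) (∙-zeroˡ f g≈0)

  ∙-expandˡ : ∀ {n} (f g h : Vector Carrier n) x → (λ k → f k + x * g k) ∙ h ≈ f ∙ h + x * g ∙ h
  ∙-expandˡ {zero} f g h x = solve 1 (λ x → con 0ℚ := con 0ℚ :+ x :* con 0ℚ) refl x
  ∙-expandˡ {suc n} f g h x = trans
    (+-congˡ (∙-expandˡ (λ k → f (suc k)) (λ k → g (suc k)) (λ k → h (suc k)) x))
    (solve 6 (λ a b c x p q → (a :+ x :* b) :* c :+ (p :+ x :* q) := a :* c :+ p :+ x :* (b :* c :+ q))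
      refl (f zero) (g zero) (h zero) x _ _)

  ∙-expandʳ : ∀ {n} (f g h : Vector Carrier n) x → h ∙ (λ k → f k + x * g k) ≈ h ∙ f + x * h ∙ g
  ∙-expandʳ f g h x = begin
    h ∙ (λ k → f k + x * g k)  ≈⟨ ∙-comm h _ ⟩
    (λ k → f k + x * g k) ∙ h  ≈⟨ ∙-expandˡ f g h x ⟩
    f ∙ h + x * g ∙ h          ≈⟨ +-cong (∙-comm f h) (*-congˡ (∙-comm g h)) ⟩
    h ∙ f + x * h ∙ g          ∎

  ∙-scaleʳ : ∀ {n} (f g : Vector Carrier n) x → f ∙ (λ k → x * g k) ≈ x * f ∙ g
  ∙-scaleʳ f g x = begin
    f ∙ (λ k → x * g k)            ≈⟨ sum-cong-≋ (λ k → solve 3 (λ f x g → f :* (x :* g) := x :* (f :* g)) refl (f k) x (g k)) ⟩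
    (sum λ k → x * (f k * g k))    ≈⟨ *-distribˡ-sum x (λ k → f k * g k) ⟨
    x * f ∙ g                      ∎

  ∙-assoc : ∀ {m n} (f : Vector Carrier m) (A : Fin m → Fin n → Carrier) (g : Vector Carrier n) →
    f ∙ (λ i → A i ∙ g) ≈ (λ k → f ∙ (λ i → A i k)) ∙ g
  ∙-assoc f A g = begin
    (sum λ i → f i * sum λ k → A i k * g k)
      ≈⟨ sum-cong-≋ (λ i → *-distribˡ-sum (f i) (λ k → A i k * g k)) ⟩
    (sum λ i → sum λ k → f i * (A i k * g k))
      ≈⟨ ∑-comm (λ i k → f i * (A i k * g k)) ⟩
    (sum λ k → sum λ i → f i * (A i k * g k))
      ≈⟨ sum-cong-≋ (λ k → sum-cong-≋ λ i → sym (*-assoc (f i) (A i k) (g k))) ⟩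
    (sum λ k → sum λ i → f i * A i k * g k)
      ≈⟨ sum-cong-≋ (λ k → sym (*-distribʳ-sum (g k) (λ i → f i * A i k))) ⟩
    (sum λ k → (sum λ i → f i * A i k) * g k) ∎

  δ : ∀ {n} → Matrix n
  δ zero    zero    = 1#
  δ zero    (suc _) = 0#
  δ (suc _) zero    = 0#
  δ (suc i) (suc j) = δ i j

  δ-diagonal : ∀ {n} (i : Fin n) → δ i i ≡ 1#
  δ-diagonal zero    = ≡.refl
  δ-diagonal (suc i) = δ-diagonal i

  δ-offDiagonal : ∀ {n} {i j : Fin n} → i ≢ j → δ i j ≡ 0#
  δ-offDiagonal {i = zero}  {zero}  i≢j = contradiction ≡.refl i≢j
  δ-offDiagonal {i = zero}  {suc j} i≢j = ≡.refl
  δ-offDiagonal {i = suc i} {zero}  i≢j = ≡.refl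
  δ-offDiagonal {i = suc i} {suc j} i≢j = δ-offDiagonal {i = i} {j} λ { ≡.refl → i≢j ≡.refl }

  δ-sym : ∀ {n} (i j : Fin n) → δ i j ≡ δ j i
  δ-sym zero    zero    = ≡.refl
  δ-sym zero    (suc j) = ≡.refl
  δ-sym (suc i) zero    = ≡.refl
  δ-sym (suc i) (suc j) = δ-sym i j

  δ∙ : ∀ {n} (i : Fin n) f → δ i ∙ f ≈ f i
  δ∙ zero    f = trans (+-cong (*-identityˡ (f zero)) (∙-zeroˡ (λ k → f (suc k)) (λ _ → refl))) (+-identityʳ (f zero))
  δ∙ (suc i) f = trans (+-cong (zeroˡ (f zero)) (δ∙ i (λ k → f (suc k)))) (+-identityˡ (f (suc i)))

  sum-single : ∀ {n} (f : Vector Carrier n) i → (∀ j → j ≢ i → f j ≈ 0#) → sum f ≈ f i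
  sum-single f i f≈0 = trans (sum-cong-≋ step) (δ∙ i f)
    where
    step : ∀ j → f j ≈ δ i j * f j
    step j with i Fin.≟ j
    ... | yes ≡.refl = sym (trans (*-congʳ (reflexive (δ-diagonal i))) (*-identityˡ (f i)))
    ... | no  i≢j    = trans (f≈0 j (λ j≡i → i≢j (≡.sym j≡i)))
      (sym (trans (*-congʳ (reflexive (δ-offDiagonal i≢j))) (zeroˡ (f j))))

  -- Orthogonal projections

  trace : ∀ {n} → Matrix n → Carrier
  trace P = sum λ i → P i i

  record IsProjection {n} (P : Matrix n) : Set where
    field
      symmetric  : ∀ i j → P i j ≈ P j i
      idempotent : ∀ i j → P i ∙ (λ k → P k j) ≈ P i j

  -- `B` is a basis of the image of `P` and `C` the dual family of coordinate functionals. With `C`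
  -- at hand, independence and spanning become explicit formulas.
  record RankFactorisation {n} (P : Matrix n) (d : ℕ) : Set where
    field
      B  : Fin d → Vector Carrier n
      C  : Fin d → Vector Carrier n
      BC : ∀ i k → (λ j → B j i) ∙ (λ j → C j k) ≈ P i k
      CB : ∀ j l → C j ∙ B l ≈ δ j l

    PB : ∀ l i → P i ∙ B l ≈ B l i
    PB l i = begin
      P i ∙ B l                                     ≈⟨ ∙-cong (λ k → BC i k) (λ _ → refl) ⟨
      (λ k → (λ j → B j i) ∙ (λ j → C j k)) ∙ B l   ≈⟨ ∙-assoc (λ j → B j i) C (B l) ⟨
      (λ j → B j i) ∙ (λ j → C j ∙ B l)             ≈⟨ ∙-cong (λ _ → refl) (λ j → trans (CB j l) (reflexive (δ-sym j l))) ⟩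
      (λ j → B j i) ∙ δ l                           ≈⟨ ∙-comm (λ j → B j i) (δ l) ⟩
      δ l ∙ (λ j → B j i)                           ≈⟨ δ∙ l (λ j → B j i) ⟩
      B l i                                         ∎

    CP : ∀ j k → C j ∙ (λ i → P i k) ≈ C j k
    CP j k = begin
      C j ∙ (λ i → P i k)                               ≈⟨ ∙-cong (λ _ → refl) (λ i → BC i k) ⟨
      C j ∙ (λ i → (λ l → B l i) ∙ (λ l → C l k))       ≈⟨ ∙-assoc (C j) (λ i l → B l i) (λ l → C l k) ⟩
      (λ l → C j ∙ B l) ∙ (λ l → C l k)                 ≈⟨ ∙-cong (CB j) (λ _ → refl) ⟩
      δ j ∙ (λ l → C l k)                               ≈⟨ δ∙ j (λ l → C l k) ⟩
      C j k                                             ∎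

  module _ {n} {P : Matrix n} (isProjection : IsProjection P) where
    open IsProjection isProjection

    -- By symmetry and idempotence, `P i i` is the sum of the squares of row `i`.
    diagonal-NonNeg : ∀ i → NonNeg (P i i)
    diagonal-NonNeg i neg = NonNeg-sum (λ k → P i k * P k i)
      (λ k neg′ → ¬Pos-neg-square (P i k) (Pos-respects-≈ (-‿cong (*-congˡ (symmetric k i))) neg′))
      (Pos-respects-≈ (-‿cong (sym (idempotent i i))) neg)

    -- A positive square `P i k * P i k` would make `P i i` positive, and then the whole trace,
    -- since no diagonal entry can be negative.
    trace-zero⇒zero : trace P ≈ 0# → ∀ i k → P i k ≈ 0#
    trace-zero⇒zero trace≈0 i k = ¬Pos-square⇒zero (P i k) λ pos →
      Pos⇒¬≈0 (Pos⇒sum-Pos (λ i → P i i) diagonal-NonNeg i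
        (Pos-respects-≈ (idempotent i i) (Pos⇒sum-Pos (λ k → P i k * P k i)
          (λ k neg → ¬Pos-neg-square (P i k) (Pos-respects-≈ (-‿cong (*-congˡ (symmetric k i))) neg))
          k (Pos-respects-≈ (*-congˡ (symmetric i k)) pos))))
        trace≈0

    module Deflation (i : Fin n) (c : Carrier) (Pᵢᵢc≈1 : P i i * c ≈ 1#) where

      b r : Vector Carrier n
      b k = c * P k i
      r k = P i k

      -- The orthogonal projection onto the part of the image of `P` that is orthogonal to column
      -- `i`. Only `b` carries the inverse pivot `c`, which gives `r ∙ b ≈ 1#` without normalising
      -- by a square root of `P i i`.
      deflated : Matrix n
      deflated k l = P k l + - b k * r l

      Pb : ∀ k → P k ∙ b ≈ b k
      Pb k = trans (∙-scaleʳ (P k) (λ l → P l i) c) (*-congˡ (idempotent k i))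

      rP : ∀ l → r ∙ (λ k → P k l) ≈ r l
      rP l = idempotent i l

      rb : r ∙ b ≈ 1#
      rb = trans (Pb i) (trans (*-comm c (P i i)) Pᵢᵢc≈1)

      r-deflated : ∀ l → r ∙ (λ k → deflated k l) ≈ 0#
      r-deflated l = begin
        r ∙ (λ k → P k l + - b k * r l)          ≈⟨ ∙-cong (λ _ → refl) (λ k → +-congˡ {P k l} (solve 2 (λ b r → :- b :* r := :- r :* b) refl (b k) (r l))) ⟩
        r ∙ (λ k → P k l + - r l * b k)          ≈⟨ ∙-expandʳ (λ k → P k l) b r (- r l) ⟩
        r ∙ (λ k → P k l) + - r l * r ∙ b        ≈⟨ +-cong (rP l) (*-congˡ rb) ⟩
        r l + - r l * 1#                         ≈⟨ solve 1 (λ r → r :+ :- r :* con 1ℚ := con 0ℚ) refl (r l) ⟩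
        0#                                       ∎

      deflated-b : ∀ k → deflated k ∙ b ≈ 0#
      deflated-b k = begin
        deflated k ∙ b                     ≈⟨ ∙-expandˡ (P k) r b (- b k) ⟩
        P k ∙ b + - b k * r ∙ b            ≈⟨ +-cong (Pb k) (*-congˡ rb) ⟩
        b k + - b k * 1#                   ≈⟨ solve 1 (λ b → b :+ :- b :* con 1ℚ := con 0ℚ) refl (b k) ⟩
        0#                                 ∎

      deflated-isProjection : IsProjection deflated
      deflated-isProjection = record
        { symmetric = λ k l → begin
            P k l + - (c * P k i) * P i l   ≈⟨ +-cong (symmetric k l) (*-cong (-‿cong (*-congˡ (symmetric k i))) (symmetric i l)) ⟩
            P l k + - (c * P i k) * P l i   ≈⟨ solve 4 (λ p q r c → p :+ :- (c :* q) :* r := p :+ :- (c :* r) :* q) refl (P l k) (P i k) (P l i) c ⟩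
            P l k + - (c * P l i) * P i k   ∎
        ; idempotent = λ k l → begin
            deflated k ∙ (λ e → P e l + - b e * r l)    ≈⟨ ∙-expandˡ (P k) r (λ e → deflated e l) (- b k) ⟩
            P k ∙ (λ e → deflated e l) + - b k * r ∙ (λ e → deflated e l) ≈⟨ +-cong (P-deflated k l) (*-congˡ (r-deflated l)) ⟩
            P k l + - b k * r l + - b k * 0#            ≈⟨ solve 3 (λ p b r → p :+ :- b :* r :+ :- b :* con 0ℚ := p :+ :- b :* r) refl (P k l) (b k) (r l) ⟩
            P k l + - b k * r l                         ∎
        }
        where
        P-deflated : ∀ k l → P k ∙ (λ e → deflated e l) ≈ deflated k l
        P-deflated k l = begin
          P k ∙ (λ e → P e l + - b e * r l)        ≈⟨ ∙-cong (λ _ → refl) (λ e → +-congˡ {P e l} (solve 2 (λ b r → :- b :* r := :- r :* b) refl (b e) (r l))) ⟩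
          P k ∙ (λ e → P e l + - r l * b e)        ≈⟨ ∙-expandʳ (λ e → P e l) b (P k) (- r l) ⟩
          P k ∙ (λ e → P e l) + - r l * P k ∙ b    ≈⟨ +-cong (idempotent k l) (*-congˡ (Pb k)) ⟩
          P k l + - r l * b k                      ≈⟨ solve 3 (λ p b r → p :+ :- r :* b := p :+ :- b :* r) refl (P k l) (b k) (r l) ⟩
          P k l + - b k * r l                      ∎

      trace-deflated : trace P ≈ trace deflated + 1#
      trace-deflated = begin
        (sum λ k → P k k)                              ≈⟨ sum-cong-≋ (λ k → solve 3 (λ p b r → p := (p :+ :- b :* r) :+ r :* b) refl (P k k) (b k) (r k)) ⟩
        (sum λ k → deflated k k + r k * b k)           ≈⟨ ∑-distrib-+ (λ k → deflated k k) (λ k → r k * b k) ⟩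
        trace deflated + r ∙ b                         ≈⟨ +-congˡ rb ⟩
        trace deflated + 1#                            ∎

      extend : ∀ {d} → RankFactorisation deflated d → RankFactorisation P (suc d)
      extend {d} factorisation = record { B = B′ ; C = C′ ; BC = B′C′ ; CB = C′B′ }
        where
        open RankFactorisation factorisation
        B′ C′ : Fin (suc d) → Vector Carrier n
        B′ zero    = b
        B′ (suc j) = B j
        C′ zero    = r
        C′ (suc j) = C j
        B′C′ : ∀ k l → (λ j → B′ j k) ∙ (λ j → C′ j l) ≈ P k l
        B′C′ k l = trans (+-congˡ (BC k l))
          (solve 3 (λ p b r → b :* r :+ (p :+ :- b :* r) := p) refl (P k l) (b k) (r l))
        C′B′ : ∀ j l → C′ j ∙ B′ l ≈ δ j l
        C′B′ zero    zero    = rb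
        -- `B l` is fixed by `deflated`, whose image `r` annihilates. The next case is the
        -- transposed argument, with `C j` and `b`.
        C′B′ zero    (suc l) = begin
          r ∙ B l                                   ≈⟨ ∙-cong (λ _ → refl) (PB l) ⟨
          r ∙ (λ k → deflated k ∙ B l)              ≈⟨ ∙-assoc r deflated (B l) ⟩
          (λ e → r ∙ (λ k → deflated k e)) ∙ B l    ≈⟨ ∙-zeroˡ (B l) r-deflated ⟩
          0#                                        ∎
        C′B′ (suc j) zero    = begin
          C j ∙ b                                   ≈⟨ ∙-cong (CP j) (λ _ → refl) ⟨
          (λ e → C j ∙ (λ k → deflated k e)) ∙ b    ≈⟨ ∙-assoc (C j) deflated b ⟨
          C j ∙ (λ k → deflated k ∙ b)              ≈⟨ ∙-zeroʳ (C j) deflated-b ⟩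
          0#                                        ∎
        C′B′ (suc j) (suc l) = CB j l

  fromNat : ℕ → Carrier
  fromNat n = ⟦ ι n ⟧

  fromNat-suc : ∀ n → fromNat (suc n) ≈ fromNat n + 1#
  fromNat-suc n = trans (reflexive (≡.cong ⟦_⟧ (≡.trans (ι-+ 1 n) (ℚ.+-comm 1ℚ (ι n))))) (⟦⟧-+ (ι n) 1ℚ)

  -- Splitting off one dimension at a pivot on the diagonal reduces the trace by one,
  -- so that a projection with integral trace is diagonalised without deciding its rank.
  rankFactorisation : ∀ {n} d {P : Matrix n} → IsProjection P → trace P ≈ fromNat d → RankFactorisation P d
  rankFactorisation zero {P} isProjection trace≈0 = record
    { B = λ () ; C = λ () ; BC = λ i k → sym (trace-zero⇒zero isProjection trace≈0 i k) ; CB = λ () }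
  rankFactorisation (suc d) {P} isProjection trace≈1+d
    with sum-Pos (λ i → P i i) (Pos-respects-≈ (sym trace≈1+d) (Pos-⟦⟧ (ι-mono-< {0} {suc d} (ℕ.s≤s ℕ.z≤n))))
  ... | i , Pᵢᵢ-Pos with Pos⇒Invertible Pᵢᵢ-Pos
  ... | c , Pᵢᵢc≈1 = extend (rankFactorisation d deflated-isProjection (begin
    trace deflated               ≈⟨ solve 1 (λ t → t := t :+ con 1ℚ :- con 1ℚ) refl (trace deflated) ⟩
    trace deflated + 1# - 1#     ≈⟨ +-congʳ trace-deflated ⟨
    trace P - 1#                 ≈⟨ +-congʳ (trans trace≈1+d (fromNat-suc d)) ⟩
    fromNat d + 1# - 1#          ≈⟨ solve 1 (λ t → t :+ con 1ℚ :- con 1ℚ := t) refl (fromNat d) ⟩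
    fromNat d                    ∎))
    where open Deflation isProjection i c Pᵢᵢc≈1

  -- Spectral decompositions

  infix 8 _·_
  _·_ : ∀ {n} → Matrix n → Vector Carrier n → Vector Carrier n
  (M · x) i = M i ∙ x

  IsEigenvector : ∀ {n} → Matrix n → Carrier → Vector Carrier n → Set
  IsEigenvector M t x = ∀ i → (M · x) i ≈ t * x i

  -- Eigenvalues are distinguished by invertible differences, because components of an eigenvector
  -- are eliminated by dividing by them.
  record SpectralDecomposition {n} (M : Matrix n) (size : ℕ) : Set where
    field
      θ            : Fin size → Carrier
      E            : Fin size → Matrix n
      multiplicity : Fin size → ℕ
      separated    : ∀ a b → a ≢ b → Invertible (θ a - θ b)
      M-symmetric  : ∀ i j → M i j ≈ M j i
      isProjection : ∀ a → IsProjection (E a)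
      eigen        : ∀ a i j → M i ∙ (λ k → E a k j) ≈ θ a * E a i j
      trace-E      : ∀ a → trace (E a) ≈ fromNat (multiplicity a)
      resolution   : ∀ i j → (sum λ a → E a i j) ≈ δ i j

    private module Projection a = IsProjection (isProjection a)

    eigenˡ : ∀ a i j → E a i ∙ (λ k → M k j) ≈ θ a * E a i j
    eigenˡ a i j = begin
      E a i ∙ (λ k → M k j)    ≈⟨ ∙-comm (E a i) (λ k → M k j) ⟩
      (λ k → M k j) ∙ E a i    ≈⟨ ∙-cong (λ k → M-symmetric k j) (λ k → Projection.symmetric a i k) ⟩
      M j ∙ (λ k → E a k i)    ≈⟨ eigen a j i ⟩
      θ a * E a j i            ≈⟨ *-congˡ (Projection.symmetric a j i) ⟩
      θ a * E a i j            ∎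

    -- Evaluating E M x in two ways gives θ E x = t E x, so the invertible factor θ - t can be
    -- cancelled.
    component-zero : ∀ {t x} → IsEigenvector M t x → ∀ a → Invertible (θ a - t) → ∀ i → (E a · x) i ≈ 0#
    component-zero {t} {x} Mx≈tx a inv i = Invertible-cancel inv (begin
      (θ a - t) * E a i ∙ x                    ≈⟨ solve 3 (λ s t y → (s :- t) :* y := s :* y :- t :* y) refl (θ a) t (E a i ∙ x) ⟩
      θ a * E a i ∙ x - t * E a i ∙ x          ≈⟨ +-congʳ both ⟩
      t * E a i ∙ x - t * E a i ∙ x            ≈⟨ -‿inverseʳ (t * E a i ∙ x) ⟩
      0#                                       ∎)
      where
      both : θ a * E a i ∙ x ≈ t * E a i ∙ x
      both = begin
        θ a * E a i ∙ x                        ≈⟨ *-congˡ (∙-comm (E a i) x) ⟩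
        θ a * x ∙ E a i                        ≈⟨ ∙-scaleʳ x (E a i) (θ a) ⟨
        x ∙ (λ j → θ a * E a i j)              ≈⟨ ∙-comm x _ ⟩
        (λ j → θ a * E a i j) ∙ x              ≈⟨ ∙-cong (eigenˡ a i) (λ _ → refl) ⟨
        (λ j → E a i ∙ (λ k → M k j)) ∙ x      ≈⟨ ∙-assoc (E a i) M x ⟨
        E a i ∙ (λ k → M k ∙ x)                ≈⟨ ∙-cong (λ _ → refl) Mx≈tx ⟩
        E a i ∙ (λ k → t * x k)                ≈⟨ ∙-scaleʳ (E a i) x t ⟩
        t * E a i ∙ x                          ∎

    -- The components E x add up to x by `resolution`, and all but the one at `b` vanish.
    single-component : ∀ {t x} → IsEigenvector M t x → ∀ b → (∀ a → a ≢ b → Invertible (θ a - t)) →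
      ∀ i → (E b · x) i ≈ x i
    single-component {t} {x} Mx≈tx b inv i = begin
      E b i ∙ x                                 ≈⟨ sum-single (λ a → E a i ∙ x) b (λ a a≢b → component-zero Mx≈tx a (inv a a≢b) i) ⟨
      (sum λ a → E a i ∙ x)                     ≈⟨ sum-cong-≋ (λ a → sym (*-identityˡ (E a i ∙ x))) ⟩
      (λ _ → 1#) ∙ (λ a → E a i ∙ x)            ≈⟨ ∙-assoc (λ _ → 1#) (λ a → E a i) x ⟩
      (λ k → (λ _ → 1#) ∙ (λ a → E a i k)) ∙ x  ≈⟨ ∙-cong (λ k → trans (sum-cong-≋ λ a → *-identityˡ (E a i k)) (resolution i k)) (λ _ → refl) ⟩
      δ i ∙ x                                   ≈⟨ δ∙ i x ⟩
      x i                                       ∎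

    -- If `t` were apart from `θ b` as well, every component of `x` would vanish. So `θ b - t` is
    -- not invertible, hence zero.
    exhaustive : ∀ {t x} → IsEigenvector M t x → ¬ (∀ i → x i ≈ 0#) →
      ∀ b → (∀ a → a ≢ b → Invertible (θ a - t)) → t ≈ θ b
    exhaustive {t} {x} Mx≈tx x≉0 b inv = sym (begin
      θ b               ≈⟨ solve 2 (λ s t → s := s :- t :+ t) refl (θ b) t ⟩
      θ b - t + t       ≈⟨ +-congʳ (¬Invertible⇒zero λ invᵇ → x≉0 λ i →
                             trans (sym (single-component Mx≈tx b inv i)) (component-zero Mx≈tx b invᵇ i)) ⟩
      0# + t            ≈⟨ +-identityˡ t ⟩
      t                 ∎)

    distinct : ∀ a b → θ a ≈ θ b → a ≡ b
    distinct a b θa≈θb with a Fin.≟ b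
    ... | yes a≡b = a≡b
    ... | no  a≢b = contradiction (begin
      1#                        ≈⟨ proj₂ (separated a b a≢b) ⟨
      (θ a - θ b) * y           ≈⟨ *-congʳ (+-congʳ θa≈θb) ⟩
      (θ b - θ b) * y           ≈⟨ solve 2 (λ t y → (t :- t) :* y := con 0ℚ) refl (θ b) y ⟩
      0#                        ∎) 1≉0
      where y = proj₁ (separated a b a≢b)

    factorisation : ∀ a → RankFactorisation (E a) (multiplicity a)
    factorisation a = rankFactorisation (multiplicity a) (isProjection a) (trace-E a)

    private module Factorisation a = RankFactorisation (factorisation a)
    open Factorisation using (B; C; PB; BC; CB)

    basis-eigenvector : ∀ a j → IsEigenvector M (θ a) (B a j)
    basis-eigenvector a j i = begin
      M i ∙ B a j                               ≈⟨ ∙-cong (λ _ → refl) (PB a j) ⟨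
      M i ∙ (λ k → E a k ∙ B a j)               ≈⟨ ∙-assoc (M i) (E a) (B a j) ⟩
      (λ l → M i ∙ (λ k → E a k l)) ∙ B a j     ≈⟨ ∙-cong (eigen a i) (λ _ → refl) ⟩
      (λ l → θ a * E a i l) ∙ B a j             ≈⟨ ∙-comm _ (B a j) ⟩
      B a j ∙ (λ l → θ a * E a i l)             ≈⟨ ∙-scaleʳ (B a j) (E a i) (θ a) ⟩
      θ a * B a j ∙ E a i                       ≈⟨ *-congˡ (∙-comm (B a j) (E a i)) ⟩
      θ a * E a i ∙ B a j                       ≈⟨ *-congˡ (PB a j i) ⟩
      θ a * B a j i                             ∎

    basis-nonzero : ∀ a j → ¬ (∀ i → B a j i ≈ 0#)
    basis-nonzero a j B≈0 = 1≉0 (begin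
      1#                ≡⟨ δ-diagonal j ⟨
      δ j j             ≈⟨ CB a j j ⟨
      C a j ∙ B a j     ≈⟨ ∙-zeroʳ (C a j) B≈0 ⟩
      0#                ∎)

    basis-independent : ∀ a c → (∀ i → c ∙ (λ j → B a j i) ≈ 0#) → ∀ j → c j ≈ 0#
    basis-independent a c Bc≈0 j = begin
      c j                                        ≈⟨ δ∙ j c ⟨
      δ j ∙ c                                    ≈⟨ ∙-cong (CB a j) (λ _ → refl) ⟨
      (λ l → C a j ∙ B a l) ∙ c                  ≈⟨ ∙-assoc (C a j) (λ i l → B a l i) c ⟨
      C a j ∙ (λ i → (λ l → B a l i) ∙ c)        ≈⟨ ∙-zeroʳ (C a j) (λ i → trans (∙-comm (λ l → B a l i) c) (Bc≈0 i)) ⟩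
      0#                                         ∎

    basis-spanning : ∀ a x → IsEigenvector M (θ a) x → ∃ λ c → ∀ i → c ∙ (λ j → B a j i) ≈ x i
    basis-spanning a x Mx≈θx = (λ j → C a j ∙ x) , λ i → begin
      (λ j → C a j ∙ x) ∙ (λ j → B a j i)         ≈⟨ ∙-comm (λ j → C a j ∙ x) (λ j → B a j i) ⟩
      (λ j → B a j i) ∙ (λ j → C a j ∙ x)         ≈⟨ ∙-assoc (λ j → B a j i) (C a) x ⟩
      (λ k → (λ j → B a j i) ∙ (λ j → C a j k)) ∙ x ≈⟨ ∙-cong (BC a i) (λ _ → refl) ⟩
      E a i ∙ x                                   ≈⟨ single-component Mx≈θx a (λ b b≢a → separated b a b≢a) i ⟩
      x i                                         ∎

-- Spectrum of the distance matrix from the algebra spanned by I, J and A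

module ConferenceMatrix (F : OrderedField) where
  open OrderedField F
  open Algebra.Properties.Semiring.Sum semiring
  open import Relation.Binary.Reasoning.Setoid setoid
  open LinearAlgebra F
  open Solver using (solve; _:=_; _:+_; _:*_; _:-_; :-_; con)

  -- `Pos-split` on x = x/2 + x/2 offers the same conclusion in both alternatives.
  ½Pos : ∀ {x} → Pos x → Pos (⟦ ½ ⟧ * x)
  ½Pos {x} pos = reduce (Pos-split (⟦ ½ ⟧ * x) (⟦ ½ ⟧ * x)
    (Pos-respects-≈ (solve 1 (λ x → x := con ½ :* x :+ con ½ :* x) refl x) pos))

  record IsConferenceMatrix {n} (a : Matrix n) (m : ℕ) : Set where
    field
      symmetric : ∀ i j → a i j ≈ a j i
      loopless  : ∀ i → a i i ≈ 0#
      degree    : ∀ i → sum (a i) ≈ ⟦ ι 2 ⟧ * fromNat m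
      square    : ∀ i j → a i ∙ (λ k → a k j) ≈ fromNat m * δ i j + fromNat m - a i j
      order     : sum {n} (λ _ → 1#) ≈ ⟦ ι 4 ⟧ * fromNat m + 1#

  module Spectrum {n} {a : Matrix n} {m} (isConferenceMatrix : IsConferenceMatrix a m) where
    open IsConferenceMatrix isConferenceMatrix

    M N : Carrier
    M = fromNat m
    N = ⟦ ι 4 ⟧ * M + 1#

    -- x I + y J + z A; these matrices form the Bose–Mesner algebra of the graph.
    bm : Carrier → Carrier → Carrier → Matrix n
    bm x y z i j = x * δ i j + y + z * a i j

    bm-symmetric : ∀ x y z i j → bm x y z i j ≈ bm x y z j i
    bm-symmetric x y z i j = +-cong (+-congʳ (*-congˡ (reflexive (δ-sym i j)))) (*-congˡ (symmetric i j))

    combination-∙ : ∀ {n} (f g h : Vector Carrier n) x y z →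
      (λ k → x * f k + y + z * g k) ∙ h ≈ x * f ∙ h + y * sum h + z * g ∙ h
    combination-∙ {zero} f g h x y z =
      solve 3 (λ x y z → con 0ℚ := x :* con 0ℚ :+ y :* con 0ℚ :+ z :* con 0ℚ) refl x y z
    combination-∙ {suc n} f g h x y z = trans
      (+-congˡ (combination-∙ (λ k → f (suc k)) (λ k → g (suc k)) (λ k → h (suc k)) x y z))
      (solve 9 (λ f g h x y z p s q → (x :* f :+ y :+ z :* g) :* h :+ (x :* p :+ y :* s :+ z :* q)
          := x :* (f :* h :+ p) :+ y :* (h :+ s) :+ z :* (g :* h :+ q))
        refl (f zero) (g zero) (h zero) x y z _ _ _)

    ∙-ones : ∀ {n} (f : Vector Carrier n) → f ∙ (λ _ → 1#) ≈ sum f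
    ∙-ones f = sum-cong-≋ λ k → *-identityʳ (f k)

    column-∙ : ∀ x y z j h → (λ k → bm x y z k j) ∙ h ≈ x * h j + y * sum h + z * a j ∙ h
    column-∙ x y z j h = trans (combination-∙ (λ k → δ k j) (λ k → a k j) h x y z)
      (+-cong (+-congʳ (*-congˡ (trans (∙-cong (λ k → reflexive (δ-sym k j)) (λ _ → refl)) (δ∙ j h))))
              (*-congˡ (∙-cong (λ k → symmetric k j) (λ _ → refl))))

    column-sum : ∀ x y z j → (sum λ k → bm x y z k j) ≈ x * 1# + y * N + z * (⟦ ι 2 ⟧ * M)
    column-sum x y z j = begin
      (sum λ k → bm x y z k j)             ≈⟨ ∙-ones (λ k → bm x y z k j) ⟨
      (λ k → bm x y z k j) ∙ (λ _ → 1#)    ≈⟨ column-∙ x y z j (λ _ → 1#) ⟩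
      x * 1# + y * sum {n} (λ _ → 1#) + z * a j ∙ (λ _ → 1#)
        ≈⟨ +-cong (+-congˡ (*-congˡ order)) (*-congˡ (trans (∙-ones (a j)) (degree j))) ⟩
      x * 1# + y * N + z * (⟦ ι 2 ⟧ * M)   ∎

    a-column : ∀ x y z i j → a i ∙ (λ k → bm x y z k j) ≈
      x * a i j + y * (⟦ ι 2 ⟧ * M) + z * (M * δ i j + M - a i j)
    a-column x y z i j = begin
      a i ∙ (λ k → bm x y z k j)    ≈⟨ ∙-comm (a i) (λ k → bm x y z k j) ⟩
      (λ k → bm x y z k j) ∙ a i    ≈⟨ column-∙ x y z j (a i) ⟩
      x * a i j + y * sum (a i) + z * a j ∙ a i
        ≈⟨ +-cong (+-congˡ (*-congˡ (degree i))) (*-congˡ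
             (trans (trans (∙-comm (a j) (a i)) (∙-cong (λ _ → refl) (λ k → symmetric j k))) (square i j))) ⟩
      x * a i j + y * (⟦ ι 2 ⟧ * M) + z * (M * δ i j + M - a i j) ∎

    -- Turns products of combinations of I, J and A into polynomials in the coefficients, `M` and
    -- the two entries `δ i j` and `a i j`. Idempotence and eigenvalue equations then become tasks
    -- for the ring solver.
    bm-product : ∀ x y z x′ y′ z′ i j → bm x y z i ∙ (λ k → bm x′ y′ z′ k j) ≈
      x * (x′ * δ i j + y′ + z′ * a i j) + y * (x′ * 1# + y′ * N + z′ * (⟦ ι 2 ⟧ * M))
      + z * (x′ * a i j + y′ * (⟦ ι 2 ⟧ * M) + z′ * (M * δ i j + M - a i j))
    bm-product x y z x′ y′ z′ i j = trans (combination-∙ (δ i) (a i) (λ k → bm x′ y′ z′ k j) x y z)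
      (+-cong (+-cong (*-congˡ (δ∙ i (λ k → bm x′ y′ z′ k j))) (*-congˡ (column-sum x′ y′ z′ j)))
              (*-congˡ (a-column x′ y′ z′ i j)))

    trace-bm : ∀ x y z → trace (bm x y z) ≈ (x + y) * N
    trace-bm x y z = begin
      (sum λ i → x * δ i i + y + z * a i i)   ≈⟨ sum-cong-≋ (λ i → +-cong (+-congʳ (*-congˡ (reflexive (δ-diagonal i)))) (*-congˡ (loopless i))) ⟩
      (sum {n} λ _ → x * 1# + y + z * 0#)       ≈⟨ sum-cong-≋ {n} (λ _ → solve 3 (λ x y z → x :* con 1ℚ :+ y :+ z :* con 0ℚ := (x :+ y) :* con 1ℚ) refl x y z) ⟩
      (sum {n} λ _ → (x + y) * 1#)            ≈⟨ *-distribˡ-sum {n} (x + y) (λ _ → 1#) ⟨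
      (x + y) * sum {n} (λ _ → 1#)            ≈⟨ *-congˡ order ⟩
      (x + y) * N                             ∎

    -- With A² = m (I + J) - A the distance matrix 2J - 2I - A has the eigenvalue 6m
    -- on the constant vectors, and (-3 ∓ √N)/2 on the images of the projections E (± 1/√N).
    distance : Matrix n
    distance = bm (- ⟦ ι 2 ⟧) ⟦ ι 2 ⟧ (- 1#)

    E₀ : Carrier → Matrix n
    E₀ p = bm 0# (p * p) 0#

    E± : Carrier → Matrix n
    E± p = bm (⟦ ½ ⟧ * (1# + p)) (- (⟦ ½ ⟧ * (p * p + p))) p

    θ₀ : Carrier
    θ₀ = ⟦ ι 6 ⟧ * M

    -- On the image of `E± p` the matrix J acts as 0 and 2A - J + I as 1/p = Np. So A acts as (Np -
    -- 1)/2, and 2J - 2I - A as -2 - (Np - 1)/2.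
    θ± : Carrier → Carrier
    θ± p = ⟦ ½ ⟧ * (- ⟦ ι 3 ⟧ - N * p)

    module _ {p} (Npp≈1 : N * (p * p) ≈ 1#) where

      -- c is the quotient of the division of x - y by N p² - 1.
      modulo : ∀ {x y} c → x ≈ y + c * (N * (p * p) - 1#) → x ≈ y
      modulo {x} {y} c eq = begin
        x                                  ≈⟨ eq ⟩
        y + c * (N * (p * p) - 1#)         ≈⟨ +-congˡ (*-congˡ (+-congʳ Npp≈1)) ⟩
        y + c * (1# - 1#)                  ≈⟨ solve 2 (λ y c → y :+ c :* (con 1ℚ :- con 1ℚ) := y) refl y c ⟩
        y                                  ∎

      E₀-isProjection : IsProjection (E₀ p)
      E₀-isProjection = record
        { symmetric = bm-symmetric 0# (p * p) 0#
        ; idempotent = λ i j → trans (bm-product 0# (p * p) 0# 0# (p * p) 0# i j) (modulo (p * p)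
            (solve 4 (λ M p d a → let N = con (ι 4) :* M :+ con 1ℚ ; x = con 0ℚ ; y = p :* p ; z = con 0ℚ in
              x :* (x :* d :+ y :+ z :* a) :+ y :* (x :* con 1ℚ :+ y :* N :+ z :* (con (ι 2) :* M))
              :+ z :* (x :* a :+ y :* (con (ι 2) :* M) :+ z :* (M :* d :+ M :- a))
              := (x :* d :+ y :+ z :* a) :+ p :* p :* (N :* (p :* p) :- con 1ℚ)) refl M p (δ i j) (a i j)))
        }

      E±-isProjection : IsProjection (E± p)
      E±-isProjection = record
        { symmetric = bm-symmetric (⟦ ½ ⟧ * (1# + p)) (- (⟦ ½ ⟧ * (p * p + p))) p
        ; idempotent = λ i j → trans (bm-product (⟦ ½ ⟧ * (1# + p)) (- (⟦ ½ ⟧ * (p * p + p))) p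
            (⟦ ½ ⟧ * (1# + p)) (- (⟦ ½ ⟧ * (p * p + p))) p i j) (modulo (⟦ ½ ⟧ * ⟦ ½ ⟧ * (δ i j + p * p))
            (solve 4 (λ M p d a → let N = con (ι 4) :* M :+ con 1ℚ ; x = con ½ :* (con 1ℚ :+ p) ; y = :- (con ½ :* (p :* p :+ p)) ; z = p in
              x :* (x :* d :+ y :+ z :* a) :+ y :* (x :* con 1ℚ :+ y :* N :+ z :* (con (ι 2) :* M))
              :+ z :* (x :* a :+ y :* (con (ι 2) :* M) :+ z :* (M :* d :+ M :- a))
              := (x :* d :+ y :+ z :* a) :+ con ½ :* con ½ :* (d :+ p :* p) :* (N :* (p :* p) :- con 1ℚ)) refl M p (δ i j) (a i j)))
        }

      E₀-eigen : ∀ i j → distance i ∙ (λ k → E₀ p k j) ≈ θ₀ * E₀ p i j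
      E₀-eigen i j = trans (bm-product (- ⟦ ι 2 ⟧) ⟦ ι 2 ⟧ (- 1#) 0# (p * p) 0# i j)
        (solve 4 (λ M p d a → let N = con (ι 4) :* M :+ con 1ℚ ; x = con 0ℚ ; y = p :* p ; z = con 0ℚ in
              :- con (ι 2) :* (x :* d :+ y :+ z :* a) :+ con (ι 2) :* (x :* con 1ℚ :+ y :* N :+ z :* (con (ι 2) :* M))
              :+ :- con 1ℚ :* (x :* a :+ y :* (con (ι 2) :* M) :+ z :* (M :* d :+ M :- a))
              := con (ι 6) :* M :* (x :* d :+ y :+ z :* a)) refl M p (δ i j) (a i j))

      E±-eigen : ∀ i j → distance i ∙ (λ k → E± p k j) ≈ θ± p * E± p i j
      E±-eigen i j = trans (bm-product (- ⟦ ι 2 ⟧) ⟦ ι 2 ⟧ (- 1#) (⟦ ½ ⟧ * (1# + p)) (- (⟦ ½ ⟧ * (p * p + p))) p i j)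
        (modulo (⟦ ½ ⟧ * ⟦ ½ ⟧ * (δ i j - p) - 1# + ⟦ ½ ⟧ * a i j)
        (solve 4 (λ M p d a → let N = con (ι 4) :* M :+ con 1ℚ ; x = con ½ :* (con 1ℚ :+ p) ; y = :- (con ½ :* (p :* p :+ p)) ; z = p in
              :- con (ι 2) :* (x :* d :+ y :+ z :* a) :+ con (ι 2) :* (x :* con 1ℚ :+ y :* N :+ z :* (con (ι 2) :* M))
              :+ :- con 1ℚ :* (x :* a :+ y :* (con (ι 2) :* M) :+ z :* (M :* d :+ M :- a))
              := con ½ :* (:- con (ι 3) :- N :* p) :* (x :* d :+ y :+ z :* a)
                 :+ (con ½ :* con ½ :* (d :- p) :- con 1ℚ :+ con ½ :* a) :* (N :* (p :* p) :- con 1ℚ)) refl M p (δ i j) (a i j)))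

      trace-E₀ : trace (E₀ p) ≈ fromNat 1
      trace-E₀ = trans (trace-bm 0# (p * p) 0#) (trans (*-congʳ (+-identityˡ (p * p))) (trans (*-comm (p * p) N) Npp≈1))

      -- Each diagonal entry is (1 - p²)/2, in which the linear terms in p have cancelled. With N p²
      -- = 1 the trace is (N - 1)/2 = 2m for either sign of p.
      trace-E± : trace (E± p) ≈ fromNat (m ℕ.+ m)
      trace-E± = begin
        trace (E± p)   ≈⟨ trace-bm (⟦ ½ ⟧ * (1# + p)) (- (⟦ ½ ⟧ * (p * p + p))) p ⟩
        (⟦ ½ ⟧ * (1# + p) + - (⟦ ½ ⟧ * (p * p + p))) * N
          ≈⟨ modulo (- ⟦ ½ ⟧) (solve 2 (λ M p → let N = con (ι 4) :* M :+ con 1ℚ in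
               (con ½ :* (con 1ℚ :+ p) :+ :- (con ½ :* (p :* p :+ p))) :* N
               := M :+ M :+ :- con ½ :* (N :* (p :* p) :- con 1ℚ)) refl M p) ⟩
        M + M          ≈⟨ ⟦⟧-+ (ι m) (ι m) ⟨
        ⟦ ι m ℚ.+ ι m ⟧ ≡⟨ ≡.cong ⟦_⟧ (ι-+ m m) ⟨
        fromNat (m ℕ.+ m) ∎

    -- Doubled, the two bounds are 0 < θ± (- p) and θ± (- p) < θ₀.
    module _ {p} (Npp≈1 : N * (p * p) ≈ 1#) (3<Np : Pos (N * p - ⟦ ι 3 ⟧))
             (Np<12M+3 : Pos (⟦ ι 12 ⟧ * M + ⟦ ι 3 ⟧ - N * p)) where

      N[-p][-p]≈1 : N * (- p * - p) ≈ 1#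
      N[-p][-p]≈1 = trans (*-congˡ (solve 1 (λ p → :- p :* :- p := p :* p) refl p)) Npp≈1

      θ : Fin 3 → Carrier
      θ zero             = θ₀
      θ (suc zero)       = θ± p
      θ (suc (suc zero)) = θ± (- p)

      E : Fin 3 → Matrix n
      E zero             = E₀ p
      E (suc zero)       = E± p
      E (suc (suc zero)) = E± (- p)

      multiplicity : Fin 3 → ℕ
      multiplicity zero    = 1
      multiplicity (suc _) = m ℕ.+ m

      Pos-θ₂ : Pos (θ± (- p))
      Pos-θ₂ = Pos-respects-≈ (solve 2 (λ N p → con ½ :* (N :* p :- con (ι 3)) := con ½ :* (:- con (ι 3) :- N :* :- p)) refl N p) (½Pos 3<Np)

      θ₀-θ₂ : Pos (θ₀ - θ± (- p))
      θ₀-θ₂ = Pos-respects-≈ (solve 3 (λ N M p → con ½ :* (con (ι 12) :* M :+ con (ι 3) :- N :* p)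
        := con (ι 6) :* M :- con ½ :* (:- con (ι 3) :- N :* :- p)) refl N M p) (½Pos Np<12M+3)

      -- The two eigenvalues θ± p and θ± (- p) add up to -3.
      Pos-−θ₁ : Pos (- θ± p)
      Pos-−θ₁ = Pos-respects-≈ (solve 2 (λ N p → con ½ :* (:- con (ι 3) :- N :* :- p) :+ con (ι 3)
        := :- (con ½ :* (:- con (ι 3) :- N :* p))) refl N p) (Pos-+ Pos-θ₂ (Pos-⟦⟧ (ℚ.positive⁻¹ (ι 3))))

      Pos-θ₀ : Pos θ₀
      Pos-θ₀ = Pos-respects-≈ (solve 2 (λ x y → x :- y :+ y := x) refl θ₀ (θ± (- p))) (Pos-+ θ₀-θ₂ Pos-θ₂)

      separated : ∀ a b → a ≢ b → Invertible (θ a - θ b)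
      separated zero             zero             a≢b = contradiction ≡.refl a≢b
      separated zero             (suc zero)       _   = Pos⇒Invertible (Pos-+ Pos-θ₀ Pos-−θ₁)
      separated zero             (suc (suc zero)) _   = Pos⇒Invertible θ₀-θ₂
      separated (suc zero)       zero             _   = Invertible-neg θ₀ (θ± p) (Pos⇒Invertible (Pos-+ Pos-θ₀ Pos-−θ₁))
      separated (suc zero)       (suc zero)       a≢b = contradiction ≡.refl a≢b
      separated (suc zero)       (suc (suc zero)) _   = Invertible-neg (θ± (- p)) (θ± p) (Pos⇒Invertible (Pos-+ Pos-θ₂ Pos-−θ₁))
      separated (suc (suc zero)) zero             _   = Invertible-neg θ₀ (θ± (- p)) (Pos⇒Invertible θ₀-θ₂)
      separated (suc (suc zero)) (suc zero)       _   = Pos⇒Invertible (Pos-+ Pos-θ₂ Pos-−θ₁)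
      separated (suc (suc zero)) (suc (suc zero)) a≢b = contradiction ≡.refl a≢b

      spectralDecomposition : SpectralDecomposition distance 3
      spectralDecomposition = record
        { θ = θ ; E = E ; multiplicity = multiplicity ; separated = separated
        ; M-symmetric = bm-symmetric (- ⟦ ι 2 ⟧) ⟦ ι 2 ⟧ (- 1#)
        ; isProjection = λ { zero → E₀-isProjection Npp≈1
                           ; (suc zero) → E±-isProjection Npp≈1
                           ; (suc (suc zero)) → E±-isProjection N[-p][-p]≈1 }
        ; eigen = λ { zero → E₀-eigen Npp≈1
                    ; (suc zero) → E±-eigen Npp≈1
                    ; (suc (suc zero)) → E±-eigen N[-p][-p]≈1 }
        ; trace-E = λ { zero → trace-E₀ Npp≈1
                      ; (suc zero) → trace-E± Npp≈1
                      ; (suc (suc zero)) → trace-E± N[-p][-p]≈1 }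
        ; resolution = λ i j → solve 3 (λ p d a →
            (con 0ℚ :* d :+ p :* p :+ con 0ℚ :* a)
            :+ ((con ½ :* (con 1ℚ :+ p) :* d :+ :- (con ½ :* (p :* p :+ p)) :+ p :* a)
            :+ ((con ½ :* (con 1ℚ :+ :- p) :* d :+ :- (con ½ :* (:- p :* :- p :+ :- p)) :+ :- p :* a)
            :+ con 0ℚ)) := d) refl p (δ i j) (a i j)
        }

      open SpectralDecomposition spectralDecomposition using (exhaustive)

      -- A positive `t` is apart from the negative eigenvalue. `Pos-split` on θ₀ - θ± (- p), cut at
      -- `t`, separates `t` from one of the two positive eigenvalues, so the other one must be `t`.
      exhaustive-Pos : ∀ {t x} → IsEigenvector distance t x → ¬ (∀ i → x i ≈ 0#) → Pos t →
        t ≈ θ₀ ⊎ t ≈ θ± (- p)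
      exhaustive-Pos {t} {x} Mx≈tx x≉0 0<t = [ below , above ]′ (Pos-split (θ₀ - t) (t - θ± (- p))
        (Pos-respects-≈ (solve 3 (λ x y t → x :- y := x :- t :+ (t :- y)) refl θ₀ (θ± (- p)) t) θ₀-θ₂))
        where
        θ₁≉t : Invertible (θ± p - t)
        θ₁≉t = Invertible-neg t (θ± p) (Pos⇒Invertible (Pos-+ 0<t Pos-−θ₁))
        below : Pos (θ₀ - t) → t ≈ θ₀ ⊎ t ≈ θ± (- p)
        below t<θ₀ = inj₂ (exhaustive Mx≈tx x≉0 (suc (suc zero))
          λ { zero _ → Pos⇒Invertible t<θ₀
            ; (suc zero) _ → θ₁≉t
            ; (suc (suc zero)) a≢a → contradiction ≡.refl a≢a })
        above : Pos (t - θ± (- p)) → t ≈ θ₀ ⊎ t ≈ θ± (- p)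
        above θ₂<t = inj₁ (exhaustive Mx≈tx x≉0 zero
          λ { zero a≢a → contradiction ≡.refl a≢a
            ; (suc zero) _ → θ₁≉t
            ; (suc (suc zero)) _ → Invertible-neg t (θ± (- p)) (Pos⇒Invertible θ₂<t) })

      -- No split is called for: a negative `t` is apart from both positive eigenvalues.
      exhaustive-Neg : ∀ {t x} → IsEigenvector distance t x → ¬ (∀ i → x i ≈ 0#) → Pos (- t) → t ≈ θ± p
      exhaustive-Neg {t} Mx≈tx x≉0 t<0 = exhaustive Mx≈tx x≉0 (suc zero)
        λ { zero _ → Pos⇒Invertible (Pos-+ Pos-θ₀ t<0)
          ; (suc zero) a≢a → contradiction ≡.refl a≢a
          ; (suc (suc zero)) _ → Pos⇒Invertible (Pos-+ Pos-θ₂ t<0) }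

open import Defs using (Graph; StronglyRegular)
open ≡ using (refl; cong; cong₂; subst)

-- Arithmetic of the conference parameters

degree≡2m : ∀ {v} k m → 2 ℕ.* k ℕ.+ 1 ≡ v → 4 ℕ.* m ℕ.+ 1 ≡ v → k ≡ 2 ℕ.* m
degree≡2m k m 2k+1≡v 4m+1≡v = ℕ.*-cancelˡ-≡ k (2 ℕ.* m) 2 (ℕ.+-cancelʳ-≡ 1 (2 ℕ.* k) (2 ℕ.* (2 ℕ.* m))
  (≡.trans 2k+1≡v (≡.trans (≡.sym 4m+1≡v) (cong (ℕ._+ 1) (ℕ.*-assoc 2 2 m)))))

1+l≡m : ∀ {v} l m → 4 ℕ.* l ℕ.+ 5 ≡ v → 4 ℕ.* m ℕ.+ 1 ≡ v → suc l ≡ m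
1+l≡m l m 4l+5≡v 4m+1≡v = ℕ.*-cancelˡ-≡ (suc l) m 4 (ℕ.+-cancelʳ-≡ 1 (4 ℕ.* suc l) (4 ℕ.* m)
  (≡.trans (solve 1 (λ l → con 4 :* (con 1 :+ l) :+ con 1 := con 4 :* l :+ con 5) refl l)
    (≡.trans 4l+5≡v (≡.sym 4m+1≡v))))
  where open ℕ.+-*-Solver

-- Orders are 1 modulo 4, so exceeding 9 = 4 · 2 + 1 means being at least 13.
3≤m : ∀ {v} m → 4 ℕ.* m ℕ.+ 1 ≡ v → v ℕ.> 9 → 3 ℕ.≤ m
3≤m m 4m+1≡v v>9 = ℕ.*-cancelˡ-< 4 2 m (ℕ.+-cancelʳ-< 1 8 (4 ℕ.* m) (subst (9 ℕ.<_) (≡.sym 4m+1≡v) v>9))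

-- Distances in a graph of diameter two

module Diameter2 {v} (G : Graph v) (μ : ℕ)
  (common : ∀ u w → u ≢ w → ¬ (Graph._~_ G u w) → card (Graph.N G u ∩ Graph.N G w) ≡ suc μ) where
  open Graph G

  -- The decisions are arguments, so that matching on them makes the distance compute.
  distanceOf : ∀ {u w} → Dec (u ≡ w) → Dec (u ~ w) → ℕ
  distanceOf (yes _) _       = 0
  distanceOf (no _)  (yes _) = 1
  distanceOf (no _)  (no _)  = 2

  ∈N⇒~ : ∀ {u w} → w ∈ N u → u ~ w
  ∈N⇒~ {u} {w} w∈Nu with u ~? w | ≡.trans (≡.sym (lookup∘tabulate (λ x → does (u ~? x)) w)) ([]=⇒lookup w∈Nu)
  ... | yes u~w | _  = u~w
  ... | no  _   | ()

  -- An empty intersection would have cardinality 0 instead of the successor `suc μ`.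
  commonNeighbour : ∀ {u w} → u ≢ w → ¬ (u ~ w) → ∃ λ x → u ~ x × x ~ w
  commonNeighbour {u} {w} u≢w u≁w with Subset.nonempty? (N u ∩ N w)
  ... | yes (x , x∈) = let x∈Nu , x∈Nw = Subset.x∈p∩q⁻ (N u) (N w) x∈ in x , ∈N⇒~ x∈Nu , ~-sym (∈N⇒~ x∈Nw)
  ... | no  empty    = contradiction
    (≡.trans (≡.sym (common u w u≢w u≁w)) (≡.trans (cong card (Subset.Empty-unique empty)) (Subset.∣⊥∣≡0 v)))
    λ ()

  isDistance : ∀ {u w} (u≟w : Dec (u ≡ w)) (u~?w : Dec (u ~ w)) → IsDistance u w (distanceOf u≟w u~?w)
  isDistance (yes refl) _         = [] , λ _ _ → ℕ.z≤n
  isDistance (no u≢w)   (yes u~w) = u~w ∷ [] , λ { zero [] → contradiction refl u≢w ; (suc _) _ → ℕ.s≤s ℕ.z≤n }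
  isDistance (no u≢w)   (no u≁w)  = let x , u~x , x~w = commonNeighbour u≢w u≁w in
    u~x ∷ (x~w ∷ []) ,
    λ { zero [] → contradiction refl u≢w
      ; (suc zero) (u~w ∷ []) → contradiction u~w u≁w
      ; (suc (suc _)) _ → ℕ.s≤s (ℕ.s≤s ℕ.z≤n) }

-- The adjacency matrix of a conference graph

module Adjacency (F : OrderedField) where
  open OrderedField F renaming (refl to ≈-refl)
  open Algebra.Properties.Semiring.Sum semiring
  open import Relation.Binary.Reasoning.Setoid setoid
  open LinearAlgebra F
  open ConferenceMatrix F using (IsConferenceMatrix; module Spectrum)
  open Solver using (solve; _:=_; _:+_; _:*_; _:-_; :-_; con)

  χ : Bool → Carrier
  χ b = if b then 1# else 0#

  -- Conjunction of bits is multiplication of their indicators. This converts counts of common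
  -- neighbours into entries of A².
  card-∩ : ∀ {n} (f g : Fin n → Bool) →
    fromNat (card (tabulate f ∩ tabulate g)) ≈ (λ i → χ (f i)) ∙ (λ i → χ (g i))
  card-∩ {zero}  f g = ≈-refl
  card-∩ {suc n} f g = step (f zero) (g zero) (tabulate (λ i → f (suc i)) ∩ tabulate (λ i → g (suc i))) (card-∩ (λ i → f (suc i)) (λ i → g (suc i)))
    where
    step : ∀ a b (p : Subset n) {s} → fromNat (card p) ≈ s →
      fromNat (card ((a ∧ b) ∷ p)) ≈ χ a * χ b + s
    step true  true  p {s} eq = trans (fromNat-suc (card p)) (trans (+-congʳ eq)
      (solve 1 (λ s → s :+ con 1ℚ := con 1ℚ :* con 1ℚ :+ s) ≈-refl s))
    step true  false p {s} eq = trans eq (solve 1 (λ s → s := con 1ℚ :* con 0ℚ :+ s) ≈-refl s)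
    step false true  p {s} eq = trans eq (solve 1 (λ s → s := con 0ℚ :* con 1ℚ :+ s) ≈-refl s)
    step false false p {s} eq = trans eq (solve 1 (λ s → s := con 0ℚ :* con 0ℚ :+ s) ≈-refl s)

  χ-idem : ∀ b → χ b * χ b ≈ χ b
  χ-idem true  = *-identityˡ 1#
  χ-idem false = zeroˡ 0#

  sum-ones : ∀ n → sum {n} (λ _ → 1#) ≈ fromNat n
  sum-ones zero    = ≈-refl
  sum-ones (suc n) = trans (+-congˡ (sum-ones n)) (trans (+-comm 1# (fromNat n)) (sym (fromNat-suc n)))

  fromNat-* : ∀ a b → fromNat (a ℕ.* b) ≈ fromNat a * fromNat b
  fromNat-* a b = trans (reflexive (cong ⟦_⟧ (ι-* a b))) (⟦⟧-* (ι a) (ι b))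

  module _ {v} (G : Graph v) where
    open Graph G

    adjacency : Matrix v
    adjacency u w = χ (does (u ~? w))

    ~⇒adjacency : ∀ {u w} → u ~ w → adjacency u w ≡ 1#
    ~⇒adjacency {u} {w} u~w = cong χ (dec-true (u ~? w) u~w)

    ≁⇒adjacency : ∀ {u w} → ¬ (u ~ w) → adjacency u w ≡ 0#
    ≁⇒adjacency {u} {w} u≁w = cong χ (dec-false (u ~? w) u≁w)

    adjacency-symmetric : ∀ u w → adjacency u w ≡ adjacency w u
    adjacency-symmetric u w = byDec (u ~? w)
      where
      byDec : Dec (u ~ w) → adjacency u w ≡ adjacency w u
      byDec (yes u~w) = ≡.trans (~⇒adjacency u~w) (≡.sym (~⇒adjacency (~-sym u~w)))
      byDec (no  u≁w) = ≡.trans (≁⇒adjacency u≁w) (≡.sym (≁⇒adjacency (λ w~u → u≁w (~-sym w~u))))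

    isConferenceMatrix : ∀ {k l m} → StronglyRegular G k l m →
      k ≡ 2 ℕ.* m → suc l ≡ m → 4 ℕ.* m ℕ.+ 1 ≡ v → IsConferenceMatrix adjacency m
    isConferenceMatrix {k} {l} {m} srg k≡2m 1+l≡m 4m+1≡v = record
      { symmetric = λ u w → reflexive (adjacency-symmetric u w)
      ; loopless  = λ u → reflexive (≁⇒adjacency (~-irr refl))
      ; degree    = degree
      ; square    = λ u w → trans (square u w) (sym (byDec u w (u Fin.≟ w) (u ~? w)))
      ; order     = begin
          sum {v} (λ _ → 1#)          ≈⟨ sum-ones v ⟩
          fromNat v                   ≡⟨ cong fromNat (≡.trans (≡.sym 4m+1≡v) (ℕ.+-comm (4 ℕ.* m) 1)) ⟩
          fromNat (suc (4 ℕ.* m))     ≈⟨ fromNat-suc (4 ℕ.* m) ⟩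
          fromNat (4 ℕ.* m) + 1#      ≈⟨ +-congʳ (fromNat-* 4 m) ⟩
          ⟦ ι 4 ⟧ * fromNat m + 1#    ∎
      }
      where
      open StronglyRegular srg
      M : Carrier
      M = fromNat m
      square : ∀ u w → adjacency u ∙ (λ x → adjacency x w) ≈ fromNat (card (N u ∩ N w))
      square u w = trans (∙-cong (λ _ → ≈-refl) (λ x → reflexive (adjacency-symmetric x w)))
        (sym (card-∩ (λ x → does (u ~? x)) (λ x → does (w ~? x))))
      card-N∩N : ∀ u → fromNat (card (N u ∩ N u)) ≈ ⟦ ι 2 ⟧ * M
      card-N∩N u = trans (reflexive (cong fromNat
        (≡.trans (cong card (Subset.∩-idem (N u))) (≡.trans (regular u) k≡2m)))) (fromNat-* 2 m)
      degree : ∀ u → sum (adjacency u) ≈ ⟦ ι 2 ⟧ * M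
      degree u = begin
        -- Entries 0 and 1 equal their squares, so the degree is a diagonal entry of A² and is
        -- covered by `card-∩` too.
        sum (adjacency u)                                ≈⟨ sum-cong-≋ (λ x → χ-idem (does (u ~? x))) ⟨
        adjacency u ∙ adjacency u                        ≈⟨ card-∩ (λ x → does (u ~? x)) (λ x → does (u ~? x)) ⟨
        fromNat (card (N u ∩ N u))                       ≈⟨ card-N∩N u ⟩
        ⟦ ι 2 ⟧ * M                                      ∎
      -- The counts 2m, l = m - 1 and m, for equal, adjacent and non-adjacent vertices, are the
      -- entries of mI + mJ - A.
      byDec : ∀ u w → Dec (u ≡ w) → Dec (u ~ w) → M * δ u w + M - adjacency u w ≈ fromNat (card (N u ∩ N w))
      byDec u .u (yes refl) _ = begin
        M * δ u u + M - adjacency u u   ≡⟨ cong₂ (λ d a → M * d + M - a) (δ-diagonal u) (≁⇒adjacency (~-irr refl)) ⟩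
        M * 1# + M - 0#                 ≈⟨ solve 1 (λ M → M :* con 1ℚ :+ M :- con 0ℚ := con (ι 2) :* M) ≈-refl M ⟩
        ⟦ ι 2 ⟧ * M                     ≈⟨ card-N∩N u ⟨
        fromNat (card (N u ∩ N u))      ∎
      byDec u w (no u≢w) (yes u~w) = begin
        M * δ u w + M - adjacency u w   ≡⟨ cong₂ (λ d a → M * d + M - a) (δ-offDiagonal u≢w) (~⇒adjacency u~w) ⟩
        M * 0# + M - 1#                 ≈⟨ +-congʳ (+-congˡ (trans (reflexive (cong fromNat (≡.sym 1+l≡m))) (fromNat-suc l))) ⟩
        M * 0# + (fromNat l + 1#) - 1#  ≈⟨ solve 2 (λ M l → M :* con 0ℚ :+ (l :+ con 1ℚ) :- con 1ℚ := l) ≈-refl M (fromNat l) ⟩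
        fromNat l                       ≡⟨ cong fromNat (adjacent u w u~w) ⟨
        fromNat (card (N u ∩ N w))      ∎
      byDec u w (no u≢w) (no u≁w) = begin
        M * δ u w + M - adjacency u w   ≡⟨ cong₂ (λ d a → M * d + M - a) (δ-offDiagonal u≢w) (≁⇒adjacency u≁w) ⟩
        M * 0# + M - 0#                 ≈⟨ solve 1 (λ M → M :* con 0ℚ :+ M :- con 0ℚ := M) ≈-refl M ⟩
        M                               ≡⟨ cong fromNat (nonadjacent u w u≢w u≁w) ⟨
        fromNat (card (N u ∩ N w))      ∎

    distance-isDistance : ∀ {m} (conf : IsConferenceMatrix adjacency m) μ common u w →
      Spectrum.distance conf u w ≈ fromNat (Diameter2.distanceOf G μ common (u Fin.≟ w) (u ~? w))
    distance-isDistance conf μ common u w = byDec (u Fin.≟ w) (u ~? w)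
      where
      open Spectrum conf
      open Diameter2 G μ common
      entry : ∀ {d a} → δ u w ≡ d → adjacency u w ≡ a → distance u w ≡ - ⟦ ι 2 ⟧ * d + ⟦ ι 2 ⟧ + - 1# * a
      entry eq₁ eq₂ = cong₂ (λ d a → - ⟦ ι 2 ⟧ * d + ⟦ ι 2 ⟧ + - 1# * a) eq₁ eq₂
      byDec : (p : Dec (u ≡ w)) (q : Dec (u ~ w)) → distance u w ≈ fromNat (distanceOf p q)
      byDec (yes refl) _ = trans (reflexive (entry (δ-diagonal u) (≁⇒adjacency (~-irr refl))))
        (solve 0 (:- con (ι 2) :* con 1ℚ :+ con (ι 2) :+ :- con 1ℚ :* con 0ℚ := con 0ℚ) ≈-refl)
      byDec (no u≢w) (yes u~w) = trans (reflexive (entry (δ-offDiagonal u≢w) (~⇒adjacency u~w)))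
        (solve 0 (:- con (ι 2) :* con 0ℚ :+ con (ι 2) :+ :- con 1ℚ :* con 1ℚ := con 1ℚ) ≈-refl)
      byDec (no u≢w) (no u≁w) = trans (reflexive (entry (δ-offDiagonal u≢w) (≁⇒adjacency u≁w)))
        (solve 0 (:- con (ι 2) :* con 0ℚ :+ con (ι 2) :+ :- con 1ℚ :* con 0ℚ := con (ι 2)) ≈-refl)

  -- The reciprocal of the square root of the order

  module InverseRoot {v} {a : Matrix v} {m} (conf : IsConferenceMatrix a m) {σ} (σ²≈v : σ * σ ≈ fromNat v)
    (3<σ : Pos (σ - fromNat 3)) (σ<1+v : Pos (fromNat (suc v) - σ)) where
    open Spectrum conf using (M; N)

    v≈N : fromNat v ≈ N
    v≈N = trans (sym (sum-ones v)) (IsConferenceMatrix.order conf)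

    N-invertible : Invertible N
    N-invertible = Pos⇒Invertible (Pos-respects-≈ (begin
      -- The two positive gaps add up to N - 2.
      (σ - ⟦ ι 3 ⟧) + (fromNat (suc v) - σ) + ⟦ ι 2 ⟧    ≈⟨ +-congʳ (+-congˡ (+-congʳ (trans (fromNat-suc v) (+-congʳ v≈N)))) ⟩
      (σ - ⟦ ι 3 ⟧) + (N + 1# - σ) + ⟦ ι 2 ⟧             ≈⟨ solve 2 (λ N σ → (σ :- con (ι 3)) :+ (N :+ con 1ℚ :- σ) :+ con (ι 2) := N) ≈-refl N σ ⟩
      N                                                  ∎)
      (Pos-+ (Pos-+ 3<σ σ<1+v) (Pos-⟦⟧ (ℚ.positive⁻¹ (ι 2)))))

    -- This is 1/σ, because σ² = N.
    p : Carrier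
    p = σ * proj₁ N-invertible

    Np≈σ : N * p ≈ σ
    Np≈σ = begin
      N * (σ * w)    ≈⟨ solve 3 (λ N σ w → N :* (σ :* w) := σ :* (N :* w)) ≈-refl N σ w ⟩
      σ * (N * w)    ≈⟨ *-congˡ (proj₂ N-invertible) ⟩
      σ * 1#         ≈⟨ *-identityʳ σ ⟩
      σ              ∎
      where w = proj₁ N-invertible

    Npp≈1 : N * (p * p) ≈ 1#
    Npp≈1 = begin
      N * (p * p)        ≈⟨ *-assoc N p p ⟨
      N * p * (σ * w)    ≈⟨ *-congʳ Np≈σ ⟩
      σ * (σ * w)        ≈⟨ *-assoc σ σ w ⟨
      σ * σ * w          ≈⟨ *-congʳ (trans σ²≈v v≈N) ⟩
      N * w              ≈⟨ proj₂ N-invertible ⟩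
      1#                 ∎
      where w = proj₁ N-invertible

    3<Np : Pos (N * p - ⟦ ι 3 ⟧)
    3<Np = Pos-respects-≈ (+-congʳ (sym Np≈σ)) 3<σ

    -- As v + 1 = 4m + 2, the gap 12m + 3 - σ exceeds v + 1 - σ by 8m + 1. The crude bound √v < v +
    -- 1 is therefore enough.
    Np<12M+3 : Pos (⟦ ι 12 ⟧ * M + ⟦ ι 3 ⟧ - N * p)
    Np<12M+3 = Pos-respects-≈ (begin
      (fromNat (suc v) - σ) + fromNat (suc (8 ℕ.* m))
        ≈⟨ +-cong (+-congʳ (trans (fromNat-suc v) (+-congʳ v≈N))) (trans (fromNat-suc (8 ℕ.* m)) (+-congʳ (fromNat-* 8 m))) ⟩
      (N + 1# - σ) + (⟦ ι 8 ⟧ * M + 1#)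
        ≈⟨ solve 2 (λ M σ → con (ι 4) :* M :+ con 1ℚ :+ con 1ℚ :- σ :+ (con (ι 8) :* M :+ con 1ℚ)
             := con (ι 12) :* M :+ con (ι 3) :- σ) ≈-refl M σ ⟩
      ⟦ ι 12 ⟧ * M + ⟦ ι 3 ⟧ - σ
        ≈⟨ +-congˡ (-‿cong Np≈σ) ⟨
      ⟦ ι 12 ⟧ * M + ⟦ ι 3 ⟧ - N * p ∎)
      (Pos-+ σ<1+v (Pos-⟦⟧ (ι-mono-< {0} {suc (8 ℕ.* m)} (ℕ.s≤s ℕ.z≤n))))

-- Cauchy sequences

open import Defs
open +-*-Solver using (solve; _:=_; _:+_; _:*_; _:-_; :-_; con)

-- Reduces a rational inequality to a known one with the same difference; the equality of
-- differences is left to the ring solver.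
shift-< : ∀ {a b p q} → a ℚ.< b → b ℚ.- a ≡ q ℚ.- p → p ℚ.< q
shift-< {a} {b} {p} {q} a<b eq = begin-strict
  p                    ≡⟨ add-difference a p ⟨
  a ℚ.+ (p ℚ.- a)      <⟨ ℚ.+-monoˡ-< (p ℚ.- a) a<b ⟩
  b ℚ.+ (p ℚ.- a)      ≡⟨ solve 3 (λ a b p → b :+ (p :- a) := p :+ (b :- a)) refl a b p ⟩
  p ℚ.+ (b ℚ.- a)      ≡⟨ cong (p ℚ.+_) eq ⟩
  p ℚ.+ (q ℚ.- p)      ≡⟨ add-difference p q ⟩
  q                    ∎
  where open ℚ.≤-Reasoning

p≤∣p∣ : ∀ p → p ℚ.≤ ∣ p ∣
p≤∣p∣ p with ℚ.≤-total 0ℚ p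
... | inj₁ 0≤p = ℚ.≤-reflexive (≡.sym (ℚ.0≤p⇒∣p∣≡p 0≤p))
... | inj₂ p≤0 = ℚ.≤-trans p≤0 (ℚ.0≤∣p∣ p)

∣p-q∣≡∣q-p∣ : ∀ p q → ∣ p ℚ.- q ∣ ≡ ∣ q ℚ.- p ∣
∣p-q∣≡∣q-p∣ p q = ≡.trans (≡.sym (ℚ.∣-p∣≡∣p∣ (p ℚ.- q)))
  (cong ∣_∣ (solve 2 (λ p q → :- (p :- q) := q :- p) refl p q))

∣p-q∣<r⇒p<q+r : ∀ {p q r} → ∣ p ℚ.- q ∣ ℚ.< r → p ℚ.< q ℚ.+ r
∣p-q∣<r⇒p<q+r {p} {q} {r} h = shift-< (ℚ.≤-<-trans (p≤∣p∣ (p ℚ.- q)) h)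
  (solve 3 (λ p q r → r :- (p :- q) := q :+ r :- p) refl p q r)

∣p∣<r : ∀ {p r} → p ℚ.< r → ℚ.- p ℚ.< r → ∣ p ∣ ℚ.< r
∣p∣<r {p} {r} p<r -p<r with ℚ.∣p∣≡p∨∣p∣≡-p p
... | inj₁ eq = subst (ℚ._< r) (≡.sym eq) p<r
... | inj₂ eq = subst (ℚ._< r) (≡.sym eq) -p<r

∣p-r∣<ε : ∀ p q r {ε} → ∣ p ℚ.- q ∣ ℚ.< ½ ℚ.* ε → ∣ q ℚ.- r ∣ ℚ.< ½ ℚ.* ε → ∣ p ℚ.- r ∣ ℚ.< ε
∣p-r∣<ε p q r {ε} h₁ h₂ = begin-strict
  ∣ p ℚ.- r ∣                      ≡⟨ cong ∣_∣ (solve 3 (λ p q r → p :- r := (p :- q) :+ (q :- r)) refl p q r) ⟩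
  ∣ (p ℚ.- q) ℚ.+ (q ℚ.- r) ∣      ≤⟨ ℚ.∣p+q∣≤∣p∣+∣q∣ (p ℚ.- q) (q ℚ.- r) ⟩
  ∣ p ℚ.- q ∣ ℚ.+ ∣ q ℚ.- r ∣      <⟨ ℚ.+-mono-< h₁ h₂ ⟩
  ½ ℚ.* ε ℚ.+ ½ ℚ.* ε              ≡⟨ ½+½ ε ⟩
  ε                                ∎
  where open ℚ.≤-Reasoning

square-nonNeg : ∀ p → 0ℚ ℚ.≤ p ℚ.* p
square-nonNeg p with ℚ.∣p∣≡p∨∣p∣≡-p p
... | inj₁ eq = ℚ.≤-trans (ℚ.0≤∣p∣ (p ℚ.* p)) (ℚ.≤-reflexive
  (≡.trans (ℚ.∣p*q∣≡∣p∣*∣q∣ p p) (cong₂ ℚ._*_ eq eq)))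
... | inj₂ eq = ℚ.≤-trans (ℚ.0≤∣p∣ (p ℚ.* p)) (ℚ.≤-reflexive
  (≡.trans (≡.trans (ℚ.∣p*q∣≡∣p∣*∣q∣ p p) (cong₂ ℚ._*_ eq eq))
    (solve 1 (λ p → (:- p) :* (:- p) := p :* p) refl p)))

-- Ring structure of the real numbers

pointwise : ∀ x y → (∀ n → seq x n ≡ seq y n) → x ≈ y
pointwise x y eq ε 0<ε = 0 , λ n _ → begin-strict
  ∣ seq x n ℚ.- seq y n ∣  ≡⟨ cong (λ q → ∣ q ℚ.- seq y n ∣) (eq n) ⟩
  ∣ seq y n ℚ.- seq y n ∣  ≡⟨ cong ∣_∣ (ℚ.+-inverseʳ (seq y n)) ⟩
  0ℚ                       <⟨ 0<ε ⟩
  ε                        ∎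
  where open ℚ.≤-Reasoning

≈-sym : ∀ x y → x ≈ y → y ≈ x
≈-sym x y x≈y ε 0<ε with x≈y ε 0<ε
... | N , h = N , λ n N≤n → subst (ℚ._< ε) (∣p-q∣≡∣q-p∣ (seq x n) (seq y n)) (h n N≤n)

≈-trans : ∀ x y z → x ≈ y → y ≈ z → x ≈ z
≈-trans x y z x≈y y≈z ε 0<ε with x≈y (½ ℚ.* ε) (½*-pos 0<ε) | y≈z (½ ℚ.* ε) (½*-pos 0<ε)
... | N , h | M , h′ = N ℕ.⊔ M , λ n N⊔M≤n →
  ∣p-r∣<ε (seq x n) (seq y n) (seq z n)
    (h n (ℕ.m⊔n≤o⇒m≤o N M N⊔M≤n)) (h′ n (ℕ.m⊔n≤o⇒n≤o N M N⊔M≤n))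

+-cong : ∀ x x′ y y′ → x ≈ x′ → y ≈ y′ → x + y ≈ x′ + y′
+-cong x x′ y y′ x≈x′ y≈y′ ε 0<ε with x≈x′ (½ ℚ.* ε) (½*-pos 0<ε) | y≈y′ (½ ℚ.* ε) (½*-pos 0<ε)
... | N , h | M , h′ = N ℕ.⊔ M , λ n N⊔M≤n → begin-strict
  ∣ (seq x n ℚ.+ seq y n) ℚ.- (seq x′ n ℚ.+ seq y′ n) ∣
    ≡⟨ cong ∣_∣ (+-difference (seq x n) (seq y n) (seq x′ n) (seq y′ n)) ⟩
  ∣ (seq x n ℚ.- seq x′ n) ℚ.+ (seq y n ℚ.- seq y′ n) ∣
    ≤⟨ ℚ.∣p+q∣≤∣p∣+∣q∣ (seq x n ℚ.- seq x′ n) (seq y n ℚ.- seq y′ n) ⟩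
  ∣ seq x n ℚ.- seq x′ n ∣ ℚ.+ ∣ seq y n ℚ.- seq y′ n ∣
    <⟨ ℚ.+-mono-< (h n (ℕ.m⊔n≤o⇒m≤o N M N⊔M≤n)) (h′ n (ℕ.m⊔n≤o⇒n≤o N M N⊔M≤n)) ⟩
  ½ ℚ.* ε ℚ.+ ½ ℚ.* ε  ≡⟨ ½+½ ε ⟩
  ε ∎
  where open ℚ.≤-Reasoning

*-congˡ : ∀ x y y′ → y ≈ y′ → x * y ≈ x * y′
*-congˡ x y y′ y≈y′ ε 0<ε with cauchy-bounded (seq x) (cauchy x)
... | B , N , posB , x<B with y≈y′ _ (1/*-pos B ε posB 0<ε)
... | M , h = N ℕ.⊔ M , λ n N⊔M≤n → begin-strict
  ∣ seq x n ℚ.* seq y n ℚ.- seq x n ℚ.* seq y′ n ∣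
    ≡⟨ cong ∣_∣ (solve 3 (λ a b c → a :* b :- a :* c := a :* (b :- c)) refl (seq x n) (seq y n) (seq y′ n)) ⟩
  ∣ seq x n ℚ.* (seq y n ℚ.- seq y′ n) ∣
    <⟨ *-small (seq x n) _ B ε posB (x<B n (ℕ.m⊔n≤o⇒m≤o N M N⊔M≤n)) (h n (ℕ.m⊔n≤o⇒n≤o N M N⊔M≤n)) ⟩
  ε ∎
  where open ℚ.≤-Reasoning

*-comm : ∀ x y → x * y ≈ y * x
*-comm x y = pointwise (x * y) (y * x) λ n → ℚ.*-comm (seq x n) (seq y n)

*-cong : ∀ x x′ y y′ → x ≈ x′ → y ≈ y′ → x * y ≈ x′ * y′
*-cong x x′ y y′ x≈x′ y≈y′ = ≈-trans (x * y) (x * y′) (x′ * y′) (*-congˡ x y y′ y≈y′)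
  (≈-trans (x * y′) (y′ * x) (x′ * y′) (*-comm x y′)
  (≈-trans (y′ * x) (y′ * x′) (x′ * y′) (*-congˡ y′ x x′ x≈x′) (*-comm y′ x′)))

infix 8 -_

abstract
  neg-cauchy : ∀ x → IsCauchy (λ n → ℚ.- seq x n)
  neg-cauchy x ε 0<ε with cauchy x ε 0<ε
  ... | N , h = N , λ m n N≤m N≤n → subst (ℚ._< ε)
    (≡.trans (≡.sym (ℚ.∣-p∣≡∣p∣ (seq x m ℚ.- seq x n)))
      (cong ∣_∣ (solve 2 (λ a b → :- (a :- b) := :- a :- :- b) refl (seq x m) (seq x n))))
    (h m n N≤m N≤n)

-_ : ℝ → ℝ
- x = mkℝ (λ n → ℚ.- seq x n) (neg-cauchy x)

-‿cong : ∀ x y → x ≈ y → - x ≈ - y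
-‿cong x y x≈y ε 0<ε with x≈y ε 0<ε
... | N , h = N , λ n N≤n → subst (ℚ._< ε)
    (≡.trans (≡.sym (ℚ.∣-p∣≡∣p∣ (seq x n ℚ.- seq y n)))
      (cong ∣_∣ (solve 2 (λ a b → :- (a :- b) := :- a :- :- b) refl (seq x n) (seq y n))))
    (h n N≤n)

ℝ-commutativeRing : CommutativeRing 0ℓ 0ℓ
ℝ-commutativeRing = record
  { Carrier = ℝ ; _≈_ = _≈_ ; _+_ = _+_ ; _*_ = _*_ ; -_ = -_ ; 0# = 0ℝ ; 1# = fromℚ 1ℚ
  ; isCommutativeRing = record
    { isRing = record
      { +-isAbelianGroup = record
        { isGroup = record
          { isMonoid = record
            { isSemigroup = record
              { isMagma = record
                { isEquivalence = record
                  { refl = λ {x} → pointwise x x λ _ → refl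
                  ; sym = λ {x} {y} → ≈-sym x y
                  ; trans = λ {x} {y} {z} → ≈-trans x y z
                  }
                ; ∙-cong = λ {x} {x′} {y} {y′} → +-cong x x′ y y′
                }
              ; assoc = λ x y z → pointwise (x + y + z) (x + (y + z)) λ n → ℚ.+-assoc (seq x n) (seq y n) (seq z n)
              }
            ; identity = (λ x → pointwise (0ℝ + x) x λ n → ℚ.+-identityˡ (seq x n))
                       , (λ x → pointwise (x + 0ℝ) x λ n → ℚ.+-identityʳ (seq x n))
            }
          ; inverse = (λ x → pointwise (- x + x) 0ℝ λ n → ℚ.+-inverseˡ (seq x n))
                    , (λ x → pointwise (x + - x) 0ℝ λ n → ℚ.+-inverseʳ (seq x n))
          ; ⁻¹-cong = λ {x} {y} → -‿cong x y
          }
        ; comm = λ x y → pointwise (x + y) (y + x) λ n → ℚ.+-comm (seq x n) (seq y n)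
        }
      ; *-cong = λ {x} {x′} {y} {y′} → *-cong x x′ y y′
      ; *-assoc = λ x y z → pointwise (x * y * z) (x * (y * z)) λ n → ℚ.*-assoc (seq x n) (seq y n) (seq z n)
      ; *-identity = (λ x → pointwise (fromℚ 1ℚ * x) x λ n → ℚ.*-identityˡ (seq x n))
                   , (λ x → pointwise (x * fromℚ 1ℚ) x λ n → ℚ.*-identityʳ (seq x n))
      ; distrib = (λ x y z → pointwise (x * (y + z)) (x * y + x * z) λ n → ℚ.*-distribˡ-+ (seq x n) (seq y n) (seq z n))
                , (λ x y z → pointwise ((y + z) * x) (y * x + z * x) λ n → ℚ.*-distribʳ-+ (seq x n) (seq y n) (seq z n))
      }
    ; *-comm = *-comm
    }
  }

-- Order and inversion on the real numbers

0<-respects-≈ : ∀ x y → x ≈ y → 0ℝ < x → 0ℝ < y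
0<-respects-≈ x y x≈y (ε , 0<ε , N , h) with x≈y (½ ℚ.* ε) (½*-pos 0<ε)
... | M , h′ = ½ ℚ.* ε , ½*-pos 0<ε , N ℕ.⊔ M , λ n N⊔M≤n →
  shift-< (ℚ.+-mono-< (h n (ℕ.m⊔n≤o⇒m≤o N M N⊔M≤n)) (∣p-q∣<r⇒p<q+r (h′ n (ℕ.m⊔n≤o⇒n≤o N M N⊔M≤n))))
    (solve 3 (λ ε x y → (x :+ (y :+ con ½ :* ε)) :- (con 0ℚ :+ ε :+ x)
      := y :- (con 0ℚ :+ con ½ :* ε)) refl ε (seq x n) (seq y n))

-- At index `M` the larger summand exceeds ε/2. From there on it moves by less than ε/4, so it stays
-- above ε/4.
0<x+y⇒0<x : ∀ x y → (pos : 0ℝ < x + y) → ∀ M → (∀ n → M ℕ.≤ n → ∣ seq x M ℚ.- seq x n ∣ ℚ.< ½ ℚ.* (½ ℚ.* proj₁ pos)) →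
  proj₁ (proj₂ (proj₂ pos)) ℕ.≤ M → seq y M ℚ.≤ seq x M → 0ℝ < x
0<x+y⇒0<x x y (ε , 0<ε , N , h) M cx N≤M y≤x = ½ ℚ.* (½ ℚ.* ε) , ½*-pos (½*-pos 0<ε) , M , λ n M≤n →
  shift-< (ℚ.+-mono-< (ℚ.*-monoʳ-<-pos ½ (ℚ.+-mono-<-≤ (h M N≤M) y≤x)) (∣p-q∣<r⇒p<q+r (cx n M≤n)))
    (solve 4 (λ ε a b c → con ½ :* (a :+ b :+ a) :+ (c :+ con ½ :* (con ½ :* ε)) :- (con ½ :* (con 0ℚ :+ ε :+ b) :+ a)
       := c :- (con 0ℚ :+ con ½ :* (con ½ :* ε))) refl ε (seq x M) (seq y M) (seq x n))

-- Comparing the two rational approximations at one late index is decidable and selects the summand.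
0<x+y⇒0<x⊎0<y : ∀ x y → 0ℝ < x + y → 0ℝ < x ⊎ 0ℝ < y
0<x+y⇒0<x⊎0<y x y pos@(ε , 0<ε , N , h)
  with cauchy x (½ ℚ.* (½ ℚ.* ε)) (½*-pos (½*-pos 0<ε)) | cauchy y (½ ℚ.* (½ ℚ.* ε)) (½*-pos (½*-pos 0<ε))
... | Nˣ , hˣ | Nʸ , hʸ = split (ℚ.≤-total (seq y M) (seq x M))
  where
  M : ℕ
  M = N ℕ.⊔ (Nˣ ℕ.⊔ Nʸ)
  N≤M : N ℕ.≤ M
  N≤M = ℕ.m≤m⊔n N (Nˣ ℕ.⊔ Nʸ)
  Nˣ≤M : Nˣ ℕ.≤ M
  Nˣ≤M = ℕ.≤-trans (ℕ.m≤m⊔n Nˣ Nʸ) (ℕ.m≤n⊔m N (Nˣ ℕ.⊔ Nʸ))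
  Nʸ≤M : Nʸ ℕ.≤ M
  Nʸ≤M = ℕ.≤-trans (ℕ.m≤n⊔m Nˣ Nʸ) (ℕ.m≤n⊔m N (Nˣ ℕ.⊔ Nʸ))
  h′ : ∀ n → N ℕ.≤ n → 0ℚ ℚ.+ ε ℚ.< seq y n ℚ.+ seq x n
  h′ n N≤n = subst (0ℚ ℚ.+ ε ℚ.<_) (ℚ.+-comm (seq x n) (seq y n)) (h n N≤n)
  split : seq y M ℚ.≤ seq x M ⊎ seq x M ℚ.≤ seq y M → 0ℝ < x ⊎ 0ℝ < y
  split (inj₁ y≤x) = inj₁ (0<x+y⇒0<x x y pos M (λ n M≤n → hˣ M n Nˣ≤M (ℕ.≤-trans Nˣ≤M M≤n)) N≤M y≤x)
  split (inj₂ x≤y) = inj₂ (0<x+y⇒0<x y x (ε , 0<ε , N , h′) M (λ n M≤n → hʸ M n Nʸ≤M (ℕ.≤-trans Nʸ≤M M≤n)) N≤M x≤y)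

-- Once the sequence varies by less than ε/4, one rational test decides. Below ε/2 at `N`, the tail
-- stays within ε of zero; otherwise it keeps absolute value above δ = ε/4, and x² would be positive
-- with gap δ².
¬0<x²⇒x≈0 : ∀ x → ¬ (0ℝ < x * x) → x ≈ 0ℝ
¬0<x²⇒x≈0 x ¬pos ε 0<ε with cauchy x (½ ℚ.* (½ ℚ.* ε)) (½*-pos (½*-pos 0<ε))
... | N , h with ∣ seq x N ∣ ℚ.<? ½ ℚ.* ε
... | yes small = N , λ n N≤n → ∣p-r∣<ε (seq x n) (seq x N) 0ℚ
        (ℚ.<-trans (h n N N≤n ℕ.≤-refl) (shift-< (½*-pos (½*-pos 0<ε))
          (solve 1 (λ ε → con ½ :* (con ½ :* ε) :- con 0ℚ := con ½ :* ε :- con ½ :* (con ½ :* ε)) refl ε)))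
        (subst (λ q → ∣ q ∣ ℚ.< ½ ℚ.* ε) (≡.sym (ℚ.+-identityʳ (seq x N))) small)
... | no ¬small = contradiction (δ ℚ.* δ , 0<δ² , N , large) ¬pos
  where
  δ : ℚ
  δ = ½ ℚ.* (½ ℚ.* ε)
  instance
    δ-positive : Positive δ
    δ-positive = ℚ.positive (½*-pos (½*-pos 0<ε))
  0<δ² : 0ℚ ℚ.< δ ℚ.* δ
  0<δ² = subst (ℚ._< δ ℚ.* δ) (ℚ.*-zeroʳ δ) (ℚ.*-monoʳ-<-pos δ (½*-pos (½*-pos 0<ε)))
  δ<∣x∣ : ∀ n → N ℕ.≤ n → δ ℚ.< ∣ seq x n ∣
  δ<∣x∣ n N≤n = shift-< (ℚ.≤-<-trans
    (ℚ.≤-trans (ℚ.≮⇒≥ ¬small) (subst (ℚ._≤ ∣ seq x n ∣ ℚ.+ ∣ seq x N ℚ.- seq x n ∣)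
      (cong ∣_∣ (add-difference (seq x n) (seq x N))) (ℚ.∣p+q∣≤∣p∣+∣q∣ (seq x n) (seq x N ℚ.- seq x n))))
    (ℚ.+-monoʳ-< ∣ seq x n ∣ (h N n ℕ.≤-refl N≤n)))
    (solve 2 (λ a ε → a :+ con ½ :* (con ½ :* ε) :- con ½ :* ε := a :- con ½ :* (con ½ :* ε)) refl (∣ seq x n ∣) ε)
  large : ∀ n → N ℕ.≤ n → 0ℚ ℚ.+ δ ℚ.* δ ℚ.< seq x n ℚ.* seq x n
  large n N≤n = begin-strict
    0ℚ ℚ.+ δ ℚ.* δ              ≡⟨ ℚ.+-identityˡ (δ ℚ.* δ) ⟩
    δ ℚ.* δ                     <⟨ ℚ.*-monoʳ-<-pos δ (δ<∣x∣ n N≤n) ⟩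
    δ ℚ.* ∣ seq x n ∣           ≤⟨ ℚ.*-monoʳ-≤-nonNeg ∣ seq x n ∣ {{ℚ.∣-∣-nonNeg (seq x n)}} (ℚ.<⇒≤ (δ<∣x∣ n N≤n)) ⟩
    ∣ seq x n ∣ ℚ.* ∣ seq x n ∣ ≡⟨ ℚ.∣p*q∣≡∣p∣*∣q∣ (seq x n) (seq x n) ⟨
    ∣ seq x n ℚ.* seq x n ∣     ≡⟨ ℚ.0≤p⇒∣p∣≡p (square-nonNeg (seq x n)) ⟩
    seq x n ℚ.* seq x n         ∎
    where open ℚ.≤-Reasoning

¬0<-x² : ∀ x → ¬ (0ℝ < - (x * x))
¬0<-x² x (ε , 0<ε , N , h) = ℚ.<-irrefl refl (begin-strict
  0ℚ                         ≡⟨ ℚ.+-identityˡ 0ℚ ⟨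
  0ℚ ℚ.+ 0ℚ                  <⟨ ℚ.+-monoʳ-< 0ℚ 0<ε ⟩
  0ℚ ℚ.+ ε                   <⟨ h N ℕ.≤-refl ⟩
  ℚ.- (seq x N ℚ.* seq x N)  ≤⟨ ℚ.neg-antimono-≤ (square-nonNeg (seq x N)) ⟩
  0ℚ                         ∎)
  where open ℚ.≤-Reasoning

-- Replacing each term by its maximum with ε makes all terms invertible, also those before `N`, and
-- alters nothing from `N` on.
0<⇒invertible : ∀ x → 0ℝ < x → ∃ λ y → x * y ≈ fromℚ 1ℚ
0<⇒invertible x (ε , 0<ε , N , h) = y , xy≈1
  where
  open ℚ.≤-Reasoning
  x⁺ : ℕ → ℚ
  x⁺ n = ε ℚ.⊔ seq x n
  ε≤x⁺ : ∀ n → ε ℚ.≤ x⁺ n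
  ε≤x⁺ n = ℚ.p≤p⊔q ε (seq x n)
  instance
    ε-positive : Positive ε
    ε-positive = ℚ.positive 0<ε
    x⁺-positive : ∀ {n} → Positive (x⁺ n)
    x⁺-positive {n} = ℚ.positive (ℚ.<-≤-trans 0<ε (ε≤x⁺ n))
  inv : ℕ → ℚ
  inv n = (1/ x⁺ n) {{ℚ.pos⇒nonZero (x⁺ n)}}
  x⁺*inv : ∀ n → x⁺ n ℚ.* inv n ≡ 1ℚ
  x⁺*inv n = ℚ.*-inverseʳ (x⁺ n) {{ℚ.pos⇒nonZero (x⁺ n)}}
  x⁺≡x : ∀ n → N ℕ.≤ n → x⁺ n ≡ seq x n
  x⁺≡x n N≤n = ℚ.p≤q⇒p⊔q≡q (ℚ.<⇒≤ (subst (ℚ._< seq x n) (ℚ.+-identityˡ ε) (h n N≤n)))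
  εinv≤1 : ∀ n → ε ℚ.* ∣ inv n ∣ ℚ.≤ 1ℚ
  εinv≤1 n = begin
    ε ℚ.* ∣ inv n ∣         ≤⟨ ℚ.*-monoʳ-≤-nonNeg ∣ inv n ∣ {{ℚ.∣-∣-nonNeg (inv n)}} (ε≤x⁺ n) ⟩
    x⁺ n ℚ.* ∣ inv n ∣      ≡⟨ cong (ℚ._* ∣ inv n ∣) (ℚ.0≤p⇒∣p∣≡p (ℚ.<⇒≤ (ℚ.positive⁻¹ (x⁺ n)))) ⟨
    ∣ x⁺ n ∣ ℚ.* ∣ inv n ∣  ≡⟨ ℚ.∣p*q∣≡∣p∣*∣q∣ (x⁺ n) (inv n) ⟨
    ∣ x⁺ n ℚ.* inv n ∣      ≡⟨ cong ∣_∣ (x⁺*inv n) ⟩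
    1ℚ                      ∎
  difference : ∀ m n → inv m ℚ.- inv n ≡ inv m ℚ.* inv n ℚ.* (x⁺ n ℚ.- x⁺ m)
  difference m n = ≡.sym (begin-equality
    inv m ℚ.* inv n ℚ.* (x⁺ n ℚ.- x⁺ m)
      ≡⟨ solve 4 (λ a b c d → c :* d :* (b :- a) := c :* (b :* d) :- d :* (a :* c)) refl (x⁺ m) (x⁺ n) (inv m) (inv n) ⟩
    inv m ℚ.* (x⁺ n ℚ.* inv n) ℚ.- inv n ℚ.* (x⁺ m ℚ.* inv m)
      ≡⟨ cong₂ (λ a b → inv m ℚ.* a ℚ.- inv n ℚ.* b) (x⁺*inv n) (x⁺*inv m) ⟩
    inv m ℚ.* 1ℚ ℚ.- inv n ℚ.* 1ℚ
      ≡⟨ cong₂ ℚ._-_ (ℚ.*-identityʳ (inv m)) (ℚ.*-identityʳ (inv n)) ⟩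
    inv m ℚ.- inv n ∎)
  inv-cauchy : IsCauchy inv
  -- All terms a, b of `x⁺` are at least ε, so the reciprocals differ by at most |a - b|/ε²; hence
  -- the precision ε²δ asked of `x`.
  inv-cauchy δ 0<δ with cauchy x (ε ℚ.* (ε ℚ.* δ)) 0<εεδ
    where
    0<εδ : 0ℚ ℚ.< ε ℚ.* δ
    0<εδ = subst (ℚ._< ε ℚ.* δ) (ℚ.*-zeroʳ ε) (ℚ.*-monoʳ-<-pos ε 0<δ)
    0<εεδ : 0ℚ ℚ.< ε ℚ.* (ε ℚ.* δ)
    0<εεδ = subst (ℚ._< ε ℚ.* (ε ℚ.* δ)) (ℚ.*-zeroʳ ε) (ℚ.*-monoʳ-<-pos ε 0<εδ)
  ... | M , hx = N ℕ.⊔ M , λ m n N⊔M≤m N⊔M≤n →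
    ℚ.*-cancelˡ-<-nonNeg ε {{ℚ.pos⇒nonNeg ε}} (ℚ.*-cancelˡ-<-nonNeg ε {{ℚ.pos⇒nonNeg ε}} (begin-strict
      ε ℚ.* (ε ℚ.* ∣ inv m ℚ.- inv n ∣)
        ≡⟨ cong (λ q → ε ℚ.* (ε ℚ.* q)) (≡.trans (cong ∣_∣ (difference m n))
             (≡.trans (ℚ.∣p*q∣≡∣p∣*∣q∣ (inv m ℚ.* inv n) (x⁺ n ℚ.- x⁺ m))
               (cong (ℚ._* ∣ x⁺ n ℚ.- x⁺ m ∣) (ℚ.∣p*q∣≡∣p∣*∣q∣ (inv m) (inv n))))) ⟩
      ε ℚ.* (ε ℚ.* (∣ inv m ∣ ℚ.* ∣ inv n ∣ ℚ.* ∣ x⁺ n ℚ.- x⁺ m ∣))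
        ≡⟨ solve 4 (λ e a b c → e :* (e :* (a :* b :* c)) := (e :* a) :* ((e :* b) :* c)) refl ε (∣ inv m ∣) (∣ inv n ∣) (∣ x⁺ n ℚ.- x⁺ m ∣) ⟩
      (ε ℚ.* ∣ inv m ∣) ℚ.* ((ε ℚ.* ∣ inv n ∣) ℚ.* ∣ x⁺ n ℚ.- x⁺ m ∣)
        ≤⟨ shrink m ((ε ℚ.* ∣ inv n ∣) ℚ.* ∣ x⁺ n ℚ.- x⁺ m ∣)
             (subst (ℚ._≤ (ε ℚ.* ∣ inv n ∣) ℚ.* ∣ x⁺ n ℚ.- x⁺ m ∣) (ℚ.*-zeroˡ ∣ x⁺ n ℚ.- x⁺ m ∣)
               (ℚ.*-monoʳ-≤-nonNeg ∣ x⁺ n ℚ.- x⁺ m ∣ {{ℚ.∣-∣-nonNeg (x⁺ n ℚ.- x⁺ m)}}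
                 (subst (ℚ._≤ ε ℚ.* ∣ inv n ∣) (ℚ.*-zeroʳ ε)
                   (ℚ.*-monoˡ-≤-nonNeg ε {{ℚ.pos⇒nonNeg ε}} (ℚ.0≤∣p∣ (inv n)))))) ⟩
      (ε ℚ.* ∣ inv n ∣) ℚ.* ∣ x⁺ n ℚ.- x⁺ m ∣
        ≤⟨ shrink n ∣ x⁺ n ℚ.- x⁺ m ∣ (ℚ.0≤∣p∣ (x⁺ n ℚ.- x⁺ m)) ⟩
      ∣ x⁺ n ℚ.- x⁺ m ∣
        ≡⟨ cong₂ (λ a b → ∣ a ℚ.- b ∣) (x⁺≡x n (ℕ.m⊔n≤o⇒m≤o N M N⊔M≤n)) (x⁺≡x m (ℕ.m⊔n≤o⇒m≤o N M N⊔M≤m)) ⟩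
      ∣ seq x n ℚ.- seq x m ∣
        <⟨ hx n m (ℕ.m⊔n≤o⇒n≤o N M N⊔M≤n) (ℕ.m⊔n≤o⇒n≤o N M N⊔M≤m) ⟩
      ε ℚ.* (ε ℚ.* δ) ∎))
    where
    shrink : ∀ k a → 0ℚ ℚ.≤ a → (ε ℚ.* ∣ inv k ∣) ℚ.* a ℚ.≤ a
    shrink k a 0≤a = begin
      (ε ℚ.* ∣ inv k ∣) ℚ.* a ≤⟨ ℚ.*-monoʳ-≤-nonNeg a {{ℚ.nonNegative 0≤a}} (εinv≤1 k) ⟩
      1ℚ ℚ.* a                ≡⟨ ℚ.*-identityˡ a ⟩
      a                       ∎
  y : ℝ
  y = mkℝ inv inv-cauchy
  xy≈1 : x * y ≈ fromℚ 1ℚ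
  xy≈1 δ 0<δ = N , λ n N≤n → begin-strict
    ∣ seq x n ℚ.* inv n ℚ.- 1ℚ ∣ ≡⟨ cong (λ q → ∣ q ℚ.* inv n ℚ.- 1ℚ ∣) (x⁺≡x n N≤n) ⟨
    ∣ x⁺ n ℚ.* inv n ℚ.- 1ℚ ∣    ≡⟨ cong (λ q → ∣ q ℚ.- 1ℚ ∣) (x⁺*inv n) ⟩
    ∣ 1ℚ ℚ.- 1ℚ ∣                ≡⟨⟩
    0ℚ                           <⟨ 0<δ ⟩
    δ                            ∎

0<q⇒0<fromℚ : ∀ q → 0ℚ ℚ.< q → 0ℝ < fromℚ q
0<q⇒0<fromℚ q 0<q = ½ ℚ.* q , ½*-pos 0<q , 0 , λ _ _ → shift-< (½*-pos 0<q)
  (solve 1 (λ q → con ½ :* q :- con 0ℚ := q :- (con 0ℚ :+ con ½ :* q)) refl q)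

x<y⇒0<y-x : ∀ x y → x < y → 0ℝ < y + - x
x<y⇒0<y-x x y (ε , 0<ε , N , h) = ε , 0<ε , N , λ n N≤n → shift-< (h n N≤n)
  (solve 3 (λ ε x y → y :- (x :+ ε) := y :- x :- (con 0ℚ :+ ε)) refl ε (seq x n) (seq y n))

p²<q²⇒p<q : ∀ {p q} → 0ℚ ℚ.≤ q → p ℚ.* p ℚ.< q ℚ.* q → p ℚ.< q
p²<q²⇒p<q {p} {q} 0≤q p²<q² with p ℚ.<? q
... | yes p<q = p<q
... | no  p≮q = contradiction (begin-strict
  p ℚ.* p  <⟨ p²<q² ⟩
  q ℚ.* q  ≤⟨ ℚ.*-monoʳ-≤-nonNeg q {{ℚ.nonNegative 0≤q}} q≤p ⟩
  p ℚ.* q  ≤⟨ ℚ.*-monoˡ-≤-nonNeg p {{ℚ.nonNegative (ℚ.≤-trans 0≤q q≤p)}} q≤p ⟩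
  p ℚ.* p  ∎) (ℚ.<-irrefl refl)
  where
  open ℚ.≤-Reasoning
  q≤p : q ℚ.≤ p
  q≤p = ℚ.≮⇒≥ p≮q

-- Integer square roots and the square root of the order

isqrt : ∀ n → ∃ λ j → j ℕ.* j ℕ.≤ n × n ℕ.< suc j ℕ.* suc j
isqrt zero = 0 , ℕ.z≤n , ℕ.s≤s ℕ.z≤n
isqrt (suc n) with isqrt n
... | j , j²≤n , n<sj² with suc j ℕ.* suc j ℕ.≤? suc n
... | yes sj²≤sn = suc j , sj²≤sn , ℕ.≤-<-trans n<sj² (ℕ.*-mono-< (ℕ.n<1+n (suc j)) (ℕ.n<1+n (suc j)))
... | no  sj²≰sn = j , ℕ.m≤n⇒m≤1+n j²≤n , ℕ.≰⇒> sj²≰sn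

-- Given directly in lowest terms, so that numerator and denominator compute for a variable `n`. The
-- denominator is `suc n`.
unitFraction : ℕ → ℚ
unitFraction n = mkℚ (+ 1) n (1-coprimeTo (suc n))

unitFraction-inverse : ∀ n → ι (suc n) ℚ.* unitFraction n ≡ 1ℚ
unitFraction-inverse n = ℚ.toℚᵘ-injective (begin
  ℚ.toℚᵘ (ι (suc n) ℚ.* unitFraction n)        ≈⟨ ℚ.toℚᵘ-homo-* (ι (suc n)) (unitFraction n) ⟩
  ℚ.toℚᵘ (ι (suc n)) ℚᵘ.* mkℚᵘ (+ 1) n         ≈⟨ ℚᵘ.*-congʳ {mkℚᵘ (+ 1) n} (toℚᵘ-ι (suc n)) ⟩
  mkℚᵘ (+ suc n) 0 ℚᵘ.* mkℚᵘ (+ 1) n           ≈⟨ ℚᵘ.*≡* (cong +_ (solveℕ n)) ⟩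
  ℚ.toℚᵘ 1ℚ                                    ∎)
  where
  open ℚᵘ.≃-Reasoning
  open ℕ.+-*-Solver renaming (solve to solve′; _:=_ to _:≡_; _:+_ to _⊕_; _:*_ to _⊗_; con to con′)
  solveℕ : ∀ n → (suc n ℕ.* 1) ℕ.* 1 ≡ 1 ℕ.* (1 ℕ.* suc n)
  solveℕ = solve′ 1 (λ n → ((con′ 1 ⊕ n) ⊗ con′ 1) ⊗ con′ 1 :≡ con′ 1 ⊗ (con′ 1 ⊗ (con′ 1 ⊕ n))) refl

0<unitFraction : ∀ n → 0ℚ ℚ.< unitFraction n
0<unitFraction n = ℚ.positive⁻¹ (unitFraction n)

archimedean : ∀ ε → 0ℚ ℚ.< ε → ∃ λ N → ∀ n → N ℕ.≤ n → unitFraction n ℚ.< ε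
archimedean (mkℚ (+ zero) d _) 0<ε = contradiction 0<ε (λ { (ℚ.*<* (ℤ.+<+ ())) })
archimedean (mkℚ (ℤ.-[1+_] _) d _) 0<ε = contradiction 0<ε (λ { (ℚ.*<* ()) })
-- A positive rational is at least the reciprocal of its denominator, here `suc d`.
archimedean (mkℚ (+ suc a) d _) _ = suc d , λ n d<n → ℚ.*<* (ℤ.+<+ (begin-strict
  1 ℕ.* suc d         ≡⟨ ℕ.*-identityˡ (suc d) ⟩
  suc d               ≤⟨ d<n ⟩
  n                   <⟨ ℕ.n<1+n n ⟩
  suc n               ≤⟨ ℕ.m≤n*m (suc n) (suc a) ⟩
  suc a ℕ.* suc n     ∎))
  where open ℕ.≤-Reasoning

-- √v is approximated from below by the best fraction j/d with d = 2(n+1);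
-- even denominators make the bound 7/2 ≤ √v visible in every term.
module SquareRoot (v : ℕ) where

  pred-d : ℕ → ℕ
  pred-d n = suc (n ℕ.+ n)

  d : ℕ → ℕ
  d n = suc (pred-d n)

  u : ℕ → ℚ
  u n = unitFraction (pred-d n)

  j : ℕ → ℕ
  j n = proj₁ (isqrt (v ℕ.* (d n ℕ.* d n)))

  s : ℕ → ℚ
  s n = ι (j n) ℚ.* u n

  instance
    u-nonNegative : ∀ {n} → ℚ.NonNegative (u n)
    u-nonNegative = _

  du : ∀ n → ι (d n) ℚ.* u n ≡ 1ℚ
  du n = unitFraction-inverse (pred-d n)

  scale : ∀ a b → (ι a ℚ.* u b) ℚ.* (ι a ℚ.* u b) ≡ ι (a ℕ.* a) ℚ.* (u b ℚ.* u b)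
  scale a b = ≡.trans (solve 2 (λ a u → (a :* u) :* (a :* u) := (a :* a) :* (u :* u)) refl (ι a) (u b))
    (cong (ℚ._* (u b ℚ.* u b)) (≡.sym (ι-* a a)))

  unscale : ∀ n → ι (v ℕ.* (d n ℕ.* d n)) ℚ.* (u n ℚ.* u n) ≡ ι v
  unscale n = begin
    ι (v ℕ.* (d n ℕ.* d n)) ℚ.* (u n ℚ.* u n)
      ≡⟨ cong (ℚ._* (u n ℚ.* u n)) (≡.trans (ι-* v (d n ℕ.* d n)) (cong (ι v ℚ.*_) (ι-* (d n) (d n)))) ⟩
    ι v ℚ.* (ι (d n) ℚ.* ι (d n)) ℚ.* (u n ℚ.* u n)
      ≡⟨ solve 3 (λ v d u → v :* (d :* d) :* (u :* u) := v :* ((d :* u) :* (d :* u))) refl (ι v) (ι (d n)) (u n) ⟩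
    ι v ℚ.* ((ι (d n) ℚ.* u n) ℚ.* (ι (d n) ℚ.* u n))
      ≡⟨ cong (λ q → ι v ℚ.* (q ℚ.* q)) (du n) ⟩
    ι v ℚ.* (1ℚ ℚ.* 1ℚ)
      ≡⟨ ℚ.*-identityʳ (ι v) ⟩
    ι v ∎
    where open ≡.≡-Reasoning

  s²≤v : ∀ n → s n ℚ.* s n ℚ.≤ ι v
  s²≤v n = begin
    s n ℚ.* s n                                ≡⟨ scale (j n) n ⟩
    ι (j n ℕ.* j n) ℚ.* (u n ℚ.* u n)          ≤⟨ ℚ.*-monoʳ-≤-nonNeg (u n ℚ.* u n) {{ℚ.nonNegative (square-nonNeg (u n))}}
                                                    (ι-mono-≤ (proj₁ (proj₂ (isqrt (v ℕ.* (d n ℕ.* d n)))))) ⟩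
    ι (v ℕ.* (d n ℕ.* d n)) ℚ.* (u n ℚ.* u n)  ≡⟨ unscale n ⟩
    ι v                                        ∎
    where open ℚ.≤-Reasoning

  v<[s+u]² : ∀ n → ι v ℚ.< (s n ℚ.+ u n) ℚ.* (s n ℚ.+ u n)
  v<[s+u]² n = begin-strict
    ι v                                        ≡⟨ unscale n ⟨
    ι (v ℕ.* (d n ℕ.* d n)) ℚ.* (u n ℚ.* u n)  <⟨ ℚ.*-monoˡ-<-pos (u n ℚ.* u n) {{ℚ.positive 0<u²}}
                                                    (ι-mono-< (proj₂ (proj₂ (isqrt (v ℕ.* (d n ℕ.* d n)))))) ⟩
    ι (suc (j n) ℕ.* suc (j n)) ℚ.* (u n ℚ.* u n) ≡⟨ scale (suc (j n)) n ⟨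
    (ι (suc (j n)) ℚ.* u n) ℚ.* (ι (suc (j n)) ℚ.* u n) ≡⟨ cong (λ q → q ℚ.* q) step ⟩
    (s n ℚ.+ u n) ℚ.* (s n ℚ.+ u n)            ∎
    where
    open ℚ.≤-Reasoning
    0<u² : 0ℚ ℚ.< u n ℚ.* u n
    0<u² = subst (ℚ._< u n ℚ.* u n) (ℚ.*-zeroʳ (u n)) (ℚ.*-monoʳ-<-pos (u n) (0<unitFraction (pred-d n)))
    step : ι (suc (j n)) ℚ.* u n ≡ s n ℚ.+ u n
    step = ≡.trans (cong (ℚ._* u n) (ι-+ 1 (j n)))
      (solve 2 (λ j u → (con 1ℚ :+ j) :* u := j :* u :+ u) refl (ι (j n)) (u n))

  0≤s : ∀ n → 0ℚ ℚ.≤ s n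
  0≤s n = subst (ℚ._≤ s n) (ℚ.*-zeroˡ (u n)) (ℚ.*-monoʳ-≤-nonNeg (u n) (ι-mono-≤ {0} {j n} ℕ.z≤n))

  -- All `s m` square to at most v and all `s n + u n` to more than v, so lower and upper
  -- approximants compare across arbitrary indices. This is what bounds the differences in
  -- `s-cauchy`.
  s<s+u : ∀ m n → s m ℚ.< s n ℚ.+ u n
  s<s+u m n = p²<q²⇒p<q (ℚ.+-mono-≤ (0≤s n) (ℚ.<⇒≤ (0<unitFraction (pred-d n))))
    (ℚ.≤-<-trans (s²≤v m) (v<[s+u]² n))

  u-small : ∀ ε → 0ℚ ℚ.< ε → ∃ λ N → ∀ n → N ℕ.≤ n → u n ℚ.< ε
  u-small ε 0<ε with archimedean ε 0<ε
  ... | N , h = N , λ n N≤n → h (pred-d n) (ℕ.≤-trans N≤n (ℕ.≤-trans (ℕ.m≤m+n n n) (ℕ.n≤1+n (n ℕ.+ n))))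

  s-cauchy : IsCauchy s
  s-cauchy ε 0<ε = let N , h = u-small ε 0<ε in N , λ m n N≤m N≤n → ∣p∣<r
    (shift-< (ℚ.+-mono-< (s<s+u m n) (h n N≤n))
      (solve 4 (λ a b u e → (b :+ u) :+ e :- (a :+ u) := e :- (a :- b)) refl (s m) (s n) (u n) ε))
    (shift-< (ℚ.+-mono-< (s<s+u n m) (h m N≤m))
      (solve 4 (λ a b u e → (a :+ u) :+ e :- (b :+ u) := e :- (:- (a :- b))) refl (s m) (s n) (u m) ε))

  √v : ℝ
  √v = mkℝ s s-cauchy

  s≤v : 1 ℕ.≤ v → ∀ n → s n ℚ.≤ ι v
  s≤v 1≤v n = ℚ.≮⇒≥ λ v<s → ℚ.<-irrefl refl (begin-strict
    ι v                ≡⟨ ℚ.*-identityˡ (ι v) ⟨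
    ι 1 ℚ.* ι v        ≤⟨ ℚ.*-monoʳ-≤-nonNeg (ι v) {{ℚ.nonNegative 0≤v}} (ι-mono-≤ 1≤v) ⟩
    ι v ℚ.* ι v        ≤⟨ ℚ.*-monoʳ-≤-nonNeg (ι v) {{ℚ.nonNegative 0≤v}} (ℚ.<⇒≤ v<s) ⟩
    s n ℚ.* ι v        <⟨ ℚ.*-monoʳ-<-pos (s n) {{ℚ.positive (ℚ.≤-<-trans 0≤v v<s)}} v<s ⟩
    s n ℚ.* s n        ≤⟨ s²≤v n ⟩
    ι v                ∎)
    where
    open ℚ.≤-Reasoning
    0≤v : 0ℚ ℚ.≤ ι v
    0≤v = ι-mono-≤ {0} {v} ℕ.z≤n

  -- The error v - s² is below (s + u)² - s² = (2s + u)u, which is at most (2v + 1)u; hence the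
  -- precision ε/(2v + 1) for `u`.
  √v-square : 1 ℕ.≤ v → √v * √v ≈ fromℕ v
  √v-square 1≤v ε 0<ε =
    let N , h = u-small (unitFraction (v ℕ.+ v) ℚ.* ε) 0<ε/[2v+1] in N , λ n N≤n → ∣p∣<r
    (ℚ.≤-<-trans (subst (s n ℚ.* s n ℚ.- ι v ℚ.≤_) (ℚ.+-inverseʳ (ι v)) (ℚ.+-monoˡ-≤ (ℚ.- ι v) (s²≤v n))) 0<ε)
    (begin-strict
      ℚ.- (s n ℚ.* s n ℚ.- ι v)
        <⟨ shift-< (v<[s+u]² n) (solve 3 (λ s u v → (s :+ u) :* (s :+ u) :- v := ((s :+ s :+ u) :* u) :- (:- (s :* s :- v))) refl (s n) (u n) (ι v)) ⟩
      (s n ℚ.+ s n ℚ.+ u n) ℚ.* u n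
        ≤⟨ ℚ.*-monoʳ-≤-nonNeg (u n) (ℚ.+-mono-≤ (ℚ.+-mono-≤ (s≤v 1≤v n) (s≤v 1≤v n)) (u≤1 n)) ⟩
      (ι v ℚ.+ ι v ℚ.+ 1ℚ) ℚ.* u n
        ≡⟨ cong (ℚ._* u n) (≡.trans (cong (ℚ._+ 1ℚ) (≡.sym (ι-+ v v))) (≡.trans (ℚ.+-comm (ι (v ℕ.+ v)) 1ℚ) (≡.sym (ι-+ 1 (v ℕ.+ v))))) ⟩
      ι (suc (v ℕ.+ v)) ℚ.* u n
        <⟨ ℚ.*-monoʳ-<-pos (ι (suc (v ℕ.+ v))) {{ℚ.positive (ι-mono-< {0} {suc (v ℕ.+ v)} (ℕ.s≤s ℕ.z≤n))}} (h n N≤n) ⟩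
      ι (suc (v ℕ.+ v)) ℚ.* (unitFraction (v ℕ.+ v) ℚ.* ε)
        ≡⟨ ℚ.*-assoc (ι (suc (v ℕ.+ v))) (unitFraction (v ℕ.+ v)) ε ⟨
      (ι (suc (v ℕ.+ v)) ℚ.* unitFraction (v ℕ.+ v)) ℚ.* ε
        ≡⟨ cong (ℚ._* ε) (unitFraction-inverse (v ℕ.+ v)) ⟩
      1ℚ ℚ.* ε
        ≡⟨ ℚ.*-identityˡ ε ⟩
      ε ∎)
    where
    open ℚ.≤-Reasoning
    0<ε/[2v+1] : 0ℚ ℚ.< unitFraction (v ℕ.+ v) ℚ.* ε
    0<ε/[2v+1] = subst (ℚ._< unitFraction (v ℕ.+ v) ℚ.* ε) (ℚ.*-zeroʳ (unitFraction (v ℕ.+ v)))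
      (ℚ.*-monoʳ-<-pos (unitFraction (v ℕ.+ v)) 0<ε)
    u≤1 : ∀ n → u n ℚ.≤ 1ℚ
    u≤1 n = ℚ.*≤* (ℤ.+≤+ (ℕ.s≤s ℕ.z≤n))

  √v<1+v : 1 ℕ.≤ v → √v < fromℕ (suc v)
  √v<1+v 1≤v = ½ , ℚ.positive⁻¹ ½ , 0 , λ n _ → begin-strict
    s n ℚ.+ ½     ≤⟨ ℚ.+-monoˡ-≤ ½ (s≤v 1≤v n) ⟩
    ι v ℚ.+ ½     <⟨ ℚ.+-monoʳ-< (ι v) (ℚ.*<* (ℤ.+<+ (ℕ.s≤s (ℕ.s≤s ℕ.z≤n)))) ⟩
    ι v ℚ.+ 1ℚ    ≡⟨ ≡.trans (ℚ.+-comm (ι v) 1ℚ) (≡.sym (ι-+ 1 v)) ⟩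
    ι (suc v)     ∎
    where open ℚ.≤-Reasoning

  -- With d = 2(n + 1), the fraction 7/2 has numerator 7(n + 1) over d. Its square 49(n + 1)² is at
  -- most 52(n + 1)² = 13d², so `isqrt` does not stop below it.
  7/2≤s : 13 ℕ.≤ v → ∀ n → + 7 ℚ./ 2 ℚ.≤ s n
  7/2≤s 13≤v n = begin
    + 7 ℚ./ 2                      ≡⟨ ℚ.*-identityʳ (+ 7 ℚ./ 2) ⟨
    + 7 ℚ./ 2 ℚ.* 1ℚ               ≡⟨ cong (+ 7 ℚ./ 2 ℚ.*_) (du n) ⟨
    + 7 ℚ./ 2 ℚ.* (ι (d n) ℚ.* u n) ≡⟨ cong (λ q → + 7 ℚ./ 2 ℚ.* (q ℚ.* u n)) (≡.trans (cong ι d≡2*) (ι-* 2 (suc n))) ⟩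
    + 7 ℚ./ 2 ℚ.* (ι 2 ℚ.* ι (suc n) ℚ.* u n) ≡⟨ solve 2 (λ n u → con (+ 7 ℚ./ 2) :* (con (ι 2) :* n :* u) := con (ι 7) :* n :* u) refl (ι (suc n)) (u n) ⟩
    ι 7 ℚ.* ι (suc n) ℚ.* u n      ≡⟨ cong (ℚ._* u n) (ι-* 7 (suc n)) ⟨
    ι (7 ℕ.* suc n) ℚ.* u n        ≤⟨ ℚ.*-monoʳ-≤-nonNeg (u n) (ι-mono-≤ 7n≤j) ⟩
    s n                            ∎
    where
    open ℚ.≤-Reasoning
    open ℕ.+-*-Solver renaming (solve to solve′; _:=_ to _:≡_; _:+_ to _⊕_; _:*_ to _⊗_; con to con′)
    d≡2* : d n ≡ 2 ℕ.* suc n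
    d≡2* = solve′ 1 (λ n → con′ 2 ⊕ (n ⊕ n) :≡ con′ 2 ⊗ (con′ 1 ⊕ n)) refl n
    7n≤j : 7 ℕ.* suc n ℕ.≤ j n
    7n≤j with 7 ℕ.* suc n ℕ.≤? j n
    ... | yes 7n≤j = 7n≤j
    ... | no  7n≰j = contradiction (ℕ.<-≤-trans (proj₂ (proj₂ (isqrt (v ℕ.* (d n ℕ.* d n)))))
      (ℕ.≤-trans (ℕ.*-mono-≤ (ℕ.≰⇒> 7n≰j) (ℕ.≰⇒> 7n≰j))
      (ℕ.≤-trans (ℕ.≤-reflexive (solve′ 1 (λ x → (con′ 7 ⊗ x) ⊗ (con′ 7 ⊗ x) :≡ con′ 49 ⊗ (x ⊗ x)) refl (suc n)))
      (ℕ.≤-trans (ℕ.*-monoˡ-≤ (suc n ℕ.* suc n) (ℕ.m≤m+n 49 3))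
      (ℕ.≤-trans (ℕ.≤-reflexive (≡.trans (solve′ 1 (λ x → con′ 52 ⊗ (x ⊗ x) :≡ con′ 13 ⊗ ((con′ 2 ⊗ x) ⊗ (con′ 2 ⊗ x))) refl (suc n))
         (cong (λ e → 13 ℕ.* (e ℕ.* e)) (≡.sym d≡2*))))
      (ℕ.*-monoˡ-≤ (d n ℕ.* d n) 13≤v)))))) (ℕ.<-irrefl refl)

  3<√v : 13 ℕ.≤ v → fromℕ 3 < √v
  -- The strict order asks for a uniform rational gap. From 3 to 7/2 there is room for 1/4, since
  -- 13/4 < 7/2 is 26 < 28 after cross-multiplication.
  3<√v 13≤v = + 1 ℚ./ 4 , ℚ.positive⁻¹ (+ 1 ℚ./ 4) , 0 , λ n _ →
    ℚ.<-≤-trans (ℚ.*<* (ℤ.+<+ (ℕ.m≤m+n 27 1))) (7/2≤s 13≤v n)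

0<x⇒0<y⇒0<x+y : ∀ x y → 0ℝ < x → 0ℝ < y → 0ℝ < x + y
0<x⇒0<y⇒0<x+y x y (ε , 0<ε , N , h) (η , 0<η , M , h′) =
  ε ℚ.+ η , ℚ.+-mono-< 0<ε 0<η , N ℕ.⊔ M , λ n N⊔M≤n →
  shift-< (ℚ.+-mono-< (h n (ℕ.m⊔n≤o⇒m≤o N M N⊔M≤n)) (h′ n (ℕ.m⊔n≤o⇒n≤o N M N⊔M≤n)))
    (solve 4 (λ a b x y → (x :+ y) :- (con 0ℚ :+ a :+ (con 0ℚ :+ b)) := x :+ y :- (con 0ℚ :+ (a :+ b)))
      refl ε η (seq x n) (seq y n))

ℝ-orderedField : OrderedField
ℝ-orderedField = record
  { Carrier           = ℝ
  ; _≈_               = _≈_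
  ; _+_               = _+_
  ; _*_               = _*_
  ; -_                = -_
  ; ⟦_⟧               = fromℚ
  ; isCommutativeRing = CommutativeRing.isCommutativeRing ℝ-commutativeRing
  ; ⟦⟧-+             = λ p q → pointwise (fromℚ (p ℚ.+ q)) (fromℚ p + fromℚ q) λ _ → refl
  ; ⟦⟧-*             = λ p q → pointwise (fromℚ (p ℚ.* q)) (fromℚ p * fromℚ q) λ _ → refl
  ; ⟦⟧-neg           = λ p → pointwise (fromℚ (ℚ.- p)) (- fromℚ p) λ _ → refl
  ; Pos              = 0ℝ <_
  ; Pos-respects-≈   = λ {x} {y} → 0<-respects-≈ x y
  ; Pos-⟦⟧           = λ {q} → 0<q⇒0<fromℚ q
  ; Pos-+            = λ {x} {y} → 0<x⇒0<y⇒0<x+y x y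
  ; Pos-split        = 0<x+y⇒0<x⊎0<y
  ; Pos⇒invertible   = 0<⇒invertible
  ; ¬Pos-square⇒zero = ¬0<x²⇒x≈0
  ; ¬Pos-neg-square  = ¬0<-x²
  }

x<0⇒0<-x : ∀ x → x < 0ℝ → 0ℝ < - x
x<0⇒0<-x x (ε , 0<ε , N , h) = ε , 0<ε , N , λ n N≤n → shift-< (h n N≤n)
  (solve 2 (λ ε x → con 0ℚ :- (x :+ ε) := :- x :- (con 0ℚ :+ ε)) refl ε (seq x n))

0<-x⇒x<0 : ∀ x → 0ℝ < - x → x < 0ℝ
0<-x⇒x<0 x (ε , 0<ε , N , h) = ε , 0<ε , N , λ n N≤n → shift-< (h n N≤n)
  (solve 2 (λ ε x → :- x :- (con 0ℚ :+ ε) := con 0ℚ :- (x :+ ε)) refl ε (seq x n))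

-- Counting the eigenvalues of each sign

module ℝLA = LinearAlgebra ℝ-orderedField
module ℝConf = ConferenceMatrix ℝ-orderedField
module ℝAdj = Adjacency ℝ-orderedField

module _ {n size} {M : Matrix n} (S : ℝLA.SpectralDecomposition M size) where
  open ℝLA.SpectralDecomposition S

  -- `select` enumerates the eigenvalues of the wanted sign, and `inhabited` names a basis vector of
  -- each eigenspace as the eigenvector to exhibit. Exhaustiveness is left to the caller because the
  -- separation of `t` depends on the sign.
  eigenvalueCount : ∀ {P : ℝ → Set} {s} (select : Fin s → Fin size) →
    (∀ {i j} → select i ≡ select j → i ≡ j) →
    (∀ i → P (θ (select i))) →
    (∀ i → Fin (multiplicity (select i))) →
    (∀ t x → Eigenspace M t x → ¬ (x ≋ 0ᵛ) → P t → ∃ λ i → t ≈ θ (select i)) →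
    EigenvalueCount M P (sumℕ λ i → multiplicity (select i))
  eigenvalueCount select injective satisfies inhabited exhaustive′ = record
    { size         = _
    ; θ            = λ i → θ (select i)
    ; mult         = λ i → multiplicity (select i)
    ; distinct     = λ {i} {j} θᵢ≈θⱼ → injective (distinct (select i) (select j) θᵢ≈θⱼ)
    ; satisfies    = satisfies
    ; eigenvalue   = λ i → basis i (inhabited i)
                         , basis-nonzero (select i) (inhabited i)
                         , basis-eigenvector (select i) (inhabited i)
    ; multiplicity = λ i → basis i , record
      { members     = basis-eigenvector (select i)
      ; independent = basis-independent (select i)
      ; spanning    = basis-spanning (select i)
      }
    ; exhaustive   = λ { t (x , x≉0 , Mx≈tx) Pt → exhaustive′ t x Mx≈tx x≉0 Pt }
    ; total        = refl
    }
    where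
    basis : ∀ i → Fin (multiplicity (select i)) → Fin n → ℝ
    basis i = ℝLA.RankFactorisation.B (factorisation (select i))

theorem1 : (v : ℕ) (G : Graph v) → v ℕ.> 9 → IsConference G → Optimistic G
theorem1 v G v>9 (k , l , zero , srg , 2k+1≡v , 4l+5≡v , 4m+1≡v) =
  contradiction (3≤m 0 4m+1≡v v>9) λ ()
-- Writing `m` as a successor yields the positive number of common neighbours for `Diameter2` and
-- makes `Fin (m ℕ.+ m)` visibly inhabited.
theorem1 v G v>9 (k , l , suc m-1 , srg , 2k+1≡v , 4l+5≡v , 4m+1≡v) =
  distance , (_ , (λ u w → isDistance (u Fin.≟ w) (u ~? w))
               , ℝAdj.distance-isDistance G conf m-1 common)
  , _ , _ , positive , negative , ℕ.n<1+n _
  where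
  open Graph G using (_~_; _~?_)
  m : ℕ
  m = suc m-1
  conf : ℝConf.IsConferenceMatrix (ℝAdj.adjacency G) m
  conf = ℝAdj.isConferenceMatrix G srg (degree≡2m k m 2k+1≡v 4m+1≡v) (1+l≡m l m 4l+5≡v 4m+1≡v) 4m+1≡v
  common : ∀ u w → u ≢ w → ¬ (u ~ w) → _
  common = StronglyRegular.nonadjacent srg
  open Diameter2 G m-1 common using (isDistance)
  open ℝConf.Spectrum conf
  13≤v : 13 ℕ.≤ v
  13≤v = subst (13 ℕ.≤_) 4m+1≡v (ℕ.+-monoˡ-≤ 1 (ℕ.*-monoʳ-≤ 4 (3≤m m 4m+1≡v v>9)))
  1≤v : 1 ℕ.≤ v
  1≤v = ℕ.≤-trans (ℕ.s≤s ℕ.z≤n) 13≤v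
  open SquareRoot v using (√v; √v-square; √v<1+v; 3<√v)
  open ℝAdj.InverseRoot conf {√v} (√v-square 1≤v) (x<y⇒0<y-x (fromℕ 3) √v (3<√v 13≤v))
    (x<y⇒0<y-x √v (fromℕ (suc v)) (√v<1+v 1≤v))
  S : ℝLA.SpectralDecomposition distance 3
  S = spectralDecomposition {p} Npp≈1 3<Np Np<12M+3

  positives : Fin 2 → Fin 3
  positives zero    = zero
  positives (suc _) = suc (suc zero)

  -- The trailing `+ 0` is the empty tail of `sumℕ`; in this form `total` holds by computation, and
  -- the two counts differ by exactly one `suc`.
  positive : n₊[ distance ]≡ suc (m ℕ.+ m ℕ.+ 0)
  positive = eigenvalueCount S positives
    (λ { {zero} {zero} _ → refl ; {suc zero} {suc zero} _ → refl ; {zero} {suc zero} () ; {suc zero} {zero} () })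
    (λ { zero → Pos-θ₀ {p} Npp≈1 3<Np Np<12M+3 ; (suc zero) → Pos-θ₂ {p} Npp≈1 3<Np Np<12M+3 })
    (λ { zero → zero ; (suc zero) → zero })
    λ t x Mx≈tx x≉0 0<t → [ (zero ,_) , (suc zero ,_) ]′
      (exhaustive-Pos {p} Npp≈1 3<Np Np<12M+3 {t} {x} Mx≈tx x≉0 0<t)

  negative : n₋[ distance ]≡ (m ℕ.+ m ℕ.+ 0)
  negative = eigenvalueCount S (λ (_ : Fin 1) → suc zero)
    (λ { {zero} {zero} _ → refl })
    (λ { zero → 0<-x⇒x<0 (θ± p) (Pos-−θ₁ {p} Npp≈1 3<Np Np<12M+3) })
    (λ { zero → zero })
    λ t x Mx≈tx x≉0 t<0 → zero ,
      exhaustive-Neg {p} Npp≈1 3<Np Np<12M+3 {t} {x} Mx≈tx x≉0 (x<0⇒0<-x t t<0)
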